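{- Let $\epsilon>0$. For all sufficiently large $m$, every odd integer $t$ with $3\le t\le \frac{1}{10}\lg\lg m$ and every positive integer $n\le m^{1-\epsilon}$, \[ s(m,n,t)=O\!\left(\exp(e^{2t})\, m^{\frac{2}{t+1}} n^{1-\frac{2}{t+1}}\lg m\right). \]
   Context: $\lg$ denotes logarithm to base $2$. Let $[m]=\{1,\dots,m\}$. An $(m,n,s)$-storing scheme is a map $\phi$ from the family of subsets of $[m]$ of size at most $n$ to $\{0,1\}^s$. An $(m,s,t)$-query scheme is a family $\{T_u\}_{u\in[m]}$ of Boolean decision trees of depth at most $t$ whose internal nodes are marked with addresses in $\{1,\dots,s\}$ (with outgoing edges labelled $0$ and $1$, so probes may be adaptive) and whose leaves are marked Yes/No. An $(m,n,s,t)$-scheme is a pair $(\phi,\{T_u\})$ such that for every $S\subseteq[m]$ with $|S|\le n$ and every $u\in[m]$, $T_u(\phi(S))=\mathrm{Yes}$ iff $u\in S$. $s(m,n,t)$ is the minimum $s$ for which an $(m,n,s,t)$-scheme exists. -}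

module Defs where

open import Data.Bool using (Bool; true; false)
open import Data.Nat as ℕ using (ℕ; zero; suc; _≤_; _+_; _*_)
open import Data.Integer using (+_)
open import Data.Fin using (Fin)
open import Data.Fin.Subset using (Subset; _∈_; ∣_∣)
open import Data.Vec using (Vec; lookup)
open import Data.Product using (_×_; ∃)
open import Data.Rational.Unnormalised as Q using (ℚᵘ; 0ℚᵘ; 1ℚᵘ)
open import Relation.Binary.PropositionalEquality using (_≡_)

Odd : ℕ → Set
Odd t = ∃ λ k → t ≡ suc (2 * k)

data DTree (s : ℕ) : ℕ → Set where
  leaf : ∀ {d} → Bool → DTree s d
  node : ∀ {d} → Fin s → DTree s d → DTree s d → DTree s (suc d)

eval : ∀ {s d} → DTree s d → Vec Bool s → Bool
eval (leaf b) w = b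
eval (node a t0 t1) w with lookup w a
... | false = eval t0 w
... | true  = eval t1 w

record Scheme (m n s t : ℕ) : Set where
  field
    store   : (S : Subset m) → ∣ S ∣ ≤ n → Vec Bool s
    query   : Fin m → DTree s t
    correct : (S : Subset m) (h : ∣ S ∣ ≤ n) (u : Fin m) →
              (eval (query u) (store S h) ≡ true → u ∈ S) ×
              (u ∈ S → eval (query u) (store S h) ≡ true)

_^ℚ_ : ℚᵘ → ℕ → ℚᵘ
x ^ℚ zero  = 1ℚᵘ
x ^ℚ suc k = x Q.* (x ^ℚ k)

expTerm : ℕ → ℚᵘ → ℚᵘ
expTerm zero    x = 1ℚᵘ
expTerm (suc k) x = (expTerm k x Q.* x) Q.* (+ 1 Q./ suc k)

expPartial : ℕ → ℚᵘ → ℚᵘ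
expPartial zero    x = 0ℚᵘ
expPartial (suc N) x = expPartial N x Q.+ expTerm N x

-- nested partial sums approximating exp(e^{2t}) from below:
-- expPartial N (expPartial K (2t)) ↑ exp(e^{2t}) as N, K → ∞
expExpApprox : ℕ → ℕ → ℕ → ℚᵘ
expExpApprox N K t = expPartial N (expPartial K (+ (2 * t) Q./ 1))

ℕtoℚ : ℕ → ℚᵘ
ℕtoℚ k = + k Q./ 1

module Submission where

-- A query for u reads a root bit, then the pointer bit on the side it names, then takes the majority of the t - 2
-- bits of one of four blocks. With t = 2k + 1, each u thus has L = 7 (t - 2) slots (those of a pointer group other
-- than its first are idle), and slot z of u is a uniformly random cell of an array of size s reserved for z.
-- Given S, call y a suspect if at least k of its slots collide with slots of S. If every set R of members and
-- suspects touches at least (L - k - 1) |R| cells, then Hall's theorem lets each of them own all but k + 1 of its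
-- slots; owners of pointers can then route the query to a block with at most k - 1 foreign slots, and owners of
-- block cells store 1 or 0 according to membership. All other cells hold 0, so non-suspects see fewer than k ones.
-- Sets R of size O(L n log m) expand by a first-moment bound. For larger R the suspects outnumber n log m, so one
-- can afford a union bound over all choices of the rows of S: k collisions with S and one further collision per
-- suspect cost about m (n / s)^k (|R| / s) / |R| < 1/4 each as soon as s^(k+1) exceeds 2^O(L) m (L n log m)^k.

-- The exponent of `s` in the expansion condition is the number of slots that an element may lose,
-- so k + 1 losses must be survived with 2k + 1 probes. A plain majority of 2k + 1 bits survives
-- only k. A pointer does better: either a slot of its group is lost, which takes one loss away from
-- the part it leads to, or it is free and can avoid a side that holds all the losses. Two pointer
-- levels thus reduce k + 1 losses to k - 1, which the majority of 2k - 1 bits survives. Arbitrary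
-- sets of more than about `s` elements cannot expand, as there are only L s cells. Large sets of
-- suspects are rarer: k of the collisions of each are with the n rows of S and cost n / s instead
-- of |R| / s. The suspects depend on the rows of S, which are themselves random. Letting a vector
-- `D` of n arbitrary rows stand for those of S removes this dependence; the s^(L n) choices of `D`
-- are absorbed by 2^|R|. Probabilities appear as counts of configurations, out of `(s ^ L) ^ m` in
-- all.

open import Defs
open import Data.Bool using (Bool; true; false; _∧_; _∨_; not; if_then_else_)
open import Data.Bool.Properties using (∨-zeroʳ; ∧-zeroʳ; ∧-identityʳ)
open import Data.Fin using (Fin; zero; suc; toℕ; fromℕ<; _↑ˡ_; _↑ʳ_; combine; remQuot)
open import Data.Fin.Properties using (_≟_; remQuot-combine)
open import Data.Fin.Subset using (Subset; _∪_; _∩_; ∣_∣; ⊥)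
open import Data.Fin.Subset.Properties using (anySubset?)
import Data.Integer as ℤ
import Data.Integer.Properties as ℤ
open import Data.List using (List; []; _∷_; _++_; map; allFin; tabulate; length; cartesianProductWith)
open import Data.List.Membership.Propositional using () renaming (_∈_ to _∈ˡ_)
open import Data.List.Membership.Propositional.Properties using (∈-allFin; ∈-cartesianProductWith⁺)
open import Data.List.Properties using (length-tabulate)
open import Data.List.Relation.Unary.All as All using (All; []; _∷_; all?)
open import Data.List.Relation.Unary.Any using (here; there)
open import Data.Maybe using (Maybe; just; nothing; maybe)
open import Data.Maybe.Properties using (just-injective)
open import Data.Nat using (ℕ; zero; suc; _≤_; _<_; _+_; _*_; _∸_; _^_; _⊔_; _/_; _!; pred; z≤n; s≤s; NonZero; >-nonZero)
open import Data.Nat.Combinatorics using (_C_; nCk+nC[k+1]≡[n+1]C[k+1]; k>n⇒nCk≡0)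
open import Data.Nat.DivMod using (m/n*n≤m; /-monoˡ-≤; m*n/n≡m)
open import Data.Nat.Logarithm using (⌊log₂_⌋; ⌊log₂⌋-mono-≤; ⌊log₂[2^n]⌋≡n)
open import Data.Nat.Properties hiding (_≟_)
open import Data.Nat.Tactic.RingSolver using (solve-∀)
open import Data.Product using (∃; ∃₂; _×_; _,_; proj₁; proj₂)
open import Data.Rational.Unnormalised as Q using (1ℚᵘ; *≤*; *≡*)
import Data.Rational.Unnormalised.Properties as Q
open import Data.Sum using (_⊎_; inj₁; inj₂)
open import Data.Unit using (tt)
open import Data.Vec as Vec using (Vec; []; _∷_; lookup; _[_]≔_; replicate; toList)
open import Data.Vec.Functional using (updateAt)
open import Data.Vec.Functional.Properties using (updateAt-updates; updateAt-minimal)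
open import Data.Vec.Properties using (lookup∘tabulate; []=⇒lookup; lookup⇒[]=; length-toList)
open import Function using (_∘_)
open import Relation.Binary.PropositionalEquality using (_≡_; _≢_; refl; sym; trans; cong; cong₂; subst; subst₂)
open import Relation.Nullary using (Dec; yes; no; does; ¬_; contradiction)
open import Relation.Nullary.Decidable using (¬?; _×-dec_; dec-true)
open import Algebra.Properties.CommutativeMonoid.Sum +-0-commutativeMonoid using (sum; sum-cong-≗; ∑-distrib-+)
open import Algebra.Properties.CommutativeMonoid.Sum *-1-commutativeMonoid using () renaming (sum to prod)

-- Finite sums

[_] : Bool → ℕ
[ false ] = 0
[ true  ] = 1

[]≤1 : ∀ b → [ b ] ≤ 1
[]≤1 false = z≤n
[]≤1 true  = s≤s z≤n

δ : ∀ {n} → Fin n → Fin n → ℕ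
δ zero    zero    = 1
δ zero    (suc j) = 0
δ (suc i) zero    = 0
δ (suc i) (suc j) = δ i j

δ-refl : ∀ {n} (i : Fin n) → δ i i ≡ 1
δ-refl zero    = refl
δ-refl (suc i) = δ-refl i

δ-positive : ∀ {n} (i j : Fin n) → 0 < δ i j → i ≡ j
δ-positive zero    zero    _ = refl
δ-positive (suc i) (suc j) p = cong suc (δ-positive i j p)

sum-mono : ∀ {n} {f g : Fin n → ℕ} → (∀ i → f i ≤ g i) → sum f ≤ sum g
sum-mono {zero}  f≤g = z≤n
sum-mono {suc n} f≤g = +-mono-≤ (f≤g zero) (sum-mono (f≤g ∘ suc))

sum-mono-< : ∀ {n} {f g : Fin n → ℕ} → (∀ i → f i ≤ g i) → ∀ i → f i < g i → sum f < sum g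
sum-mono-< {suc n} f≤g zero    p = +-mono-≤ p (sum-mono (f≤g ∘ suc))
sum-mono-< {suc n} f≤g (suc i) p =
  ≤-trans (≤-reflexive (sym (+-suc _ _))) (+-mono-≤ (f≤g zero) (sum-mono-< (f≤g ∘ suc) i p))

sum-const : ∀ n c → sum {n} (λ _ → c) ≡ n * c
sum-const zero    c = refl
sum-const (suc n) c = cong (c +_) (sum-const n c)

term≤sum : ∀ {n} (f : Fin n → ℕ) i → f i ≤ sum f
term≤sum f zero    = m≤m+n _ _
term≤sum f (suc i) = ≤-trans (term≤sum (f ∘ suc) i) (m≤n+m _ _)

sum-δ : ∀ {n} (i : Fin n) → sum (δ i) ≡ 1
sum-δ {suc n} zero    = cong suc (trans (sum-const n 0) (*-zeroʳ n))
sum-δ {suc n} (suc i) = sum-δ i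

sum-*ˡ : ∀ {n} c (f : Fin n → ℕ) → sum (λ i → c * f i) ≡ c * sum f
sum-*ˡ {zero}  c f = sym (*-zeroʳ c)
sum-*ˡ {suc n} c f = trans (cong (c * f zero +_) (sum-*ˡ c (f ∘ suc))) (sym (*-distribˡ-+ c (f zero) _))

sum-*δ : ∀ {n} c (i : Fin n) → sum (λ j → c * δ i j) ≡ c
sum-*δ c i = trans (sum-*ˡ c (δ i)) (trans (cong (c *_) (sum-δ i)) (*-identityʳ c))

positive-term : ∀ {n} (f : Fin n → ℕ) → 0 < sum f → ∃ λ i → 0 < f i
positive-term {suc n} f p with f zero in eq
... | suc x = zero , subst (0 <_) (sym eq) (s≤s z≤n)
... | zero  with positive-term (f ∘ suc) p
...   | i , q = suc i , q

sum-++ : ∀ m {n} (f : Fin (m + n) → ℕ) →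
         sum f ≡ sum (λ i → f (i ↑ˡ n)) + sum (λ i → f (m ↑ʳ i))
sum-++ zero    f = refl
sum-++ (suc m) f = trans (cong (f zero +_) (sum-++ m (f ∘ suc))) (sym (+-assoc (f zero) _ _))

sum-combine : ∀ m {n} (f : Fin (m * n) → ℕ) →
              sum f ≡ sum (λ i → sum (λ j → f (combine {m} {n} i j)))
sum-combine zero        f = refl
sum-combine (suc m) {n} f = trans (sum-++ n f) (cong (sum (λ j → f (j ↑ˡ (m * n))) +_) (sum-combine m (f ∘ (n ↑ʳ_))))

-- Hall's theorem with demands

Incidence : ℕ → ℕ → Set
Incidence a s = Fin a → Fin s → Bool

covers : ∀ {a s} → Incidence a s → Subset a → Fin s → Bool
covers N []      x = false
covers N (b ∷ R) x = (b ∧ N zero x) ∨ covers (N ∘ suc) R x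

coverage : ∀ {a s} → Incidence a s → Subset a → ℕ
coverage N R = sum (λ x → [ covers N R x ])

weight : ∀ {a} → (Fin a → ℕ) → Subset a → ℕ
weight d []      = 0
weight d (b ∷ R) = [ b ] * d zero + weight (d ∘ suc) R

HallCondition : ∀ {a s} → Incidence a s → (Fin a → ℕ) → Set
HallCondition N d = ∀ R → weight d R ≤ coverage N R

weight-∪-∩ : ∀ {a} (d : Fin a → ℕ) P R → weight d (P ∪ R) + weight d (P ∩ R) ≡ weight d P + weight d R
weight-∪-∩ d []      []      = refl
weight-∪-∩ d (b ∷ P) (c ∷ R) =
  trans (+-lemma ([ b ∨ c ] * d zero) _ ([ b ∧ c ] * d zero) _)
  (trans (cong₂ _+_ (head≡ b c) (weight-∪-∩ (d ∘ suc) P R))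
  (sym (+-lemma ([ b ] * d zero) _ ([ c ] * d zero) _)))
  where
  +-lemma : ∀ w x y z → (w + x) + (y + z) ≡ (w + y) + (x + z)
  +-lemma = solve-∀
  head≡ : ∀ b c → [ b ∨ c ] * d zero + [ b ∧ c ] * d zero ≡ [ b ] * d zero + [ c ] * d zero
  head≡ false c     = +-identityʳ _
  head≡ true  false = refl
  head≡ true  true  = refl

covers-∪ : ∀ {a s} (N : Incidence a s) P R x → covers N (P ∪ R) x ≡ covers N P x ∨ covers N R x
covers-∪ N []      []      x = refl
covers-∪ N (b ∷ P) (c ∷ R) x rewrite covers-∪ (N ∘ suc) P R x = interchange b c (N zero x) _
  where
  interchange : ∀ b c n p {r} → (b ∨ c) ∧ n ∨ (p ∨ r) ≡ (b ∧ n ∨ p) ∨ (c ∧ n ∨ r)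
  interchange false false n     p     = refl
  interchange false true  false p     = refl
  interchange false true  true  p     = sym (∨-zeroʳ p)
  interchange true  false false p     = refl
  interchange true  true  false p     = refl
  interchange true  c     true  p     = refl

-- Equality fails in general, because `P` and `R` may cover `x` through different elements. The
-- inequality points the way submodularity needs.
covers-∩ : ∀ {a s} (N : Incidence a s) P R x → [ covers N (P ∩ R) x ] ≤ [ covers N P x ∧ covers N R x ]
covers-∩ N []      []      x = z≤n
covers-∩ N (b ∷ P) (c ∷ R) x = interchange b c (N zero x) _ _ _ (covers-∩ (N ∘ suc) P R x)
  where
  interchange : ∀ b c n p r q → [ q ] ≤ [ p ∧ r ] → [ (b ∧ c) ∧ n ∨ q ] ≤ [ (b ∧ n ∨ p) ∧ (c ∧ n ∨ r) ]
  interchange false false n     p     r     q     le = le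
  interchange false true  false p     r     q     le = le
  interchange false true  true  true  r     q     le = []≤1 q
  interchange false true  true  false r     q     le = le
  interchange true  false false p     r     q     le = le
  interchange true  false true  true  r     q     le = le
  interchange true  false true  false true  q     le = []≤1 q
  interchange true  false true  false false q     le = le
  interchange true  true  false p     r     q     le = le
  interchange true  true  true  p     r     q     le = ≤-refl

-- Since `weight` is modular, submodularity of `coverage` makes tight sets closed under union.
coverage-submodular : ∀ {a s} (N : Incidence a s) P R →
                      coverage N (P ∪ R) + coverage N (P ∩ R) ≤ coverage N P + coverage N R
coverage-submodular N P R = begin
  coverage N (P ∪ R) + coverage N (P ∩ R)                        ≡⟨ ∑-distrib-+ {_} (λ x → [ covers N (P ∪ R) x ]) _ ⟨
  sum (λ x → [ covers N (P ∪ R) x ] + [ covers N (P ∩ R) x ])    ≤⟨ sum-mono pointwise ⟩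
  sum (λ x → [ covers N P x ] + [ covers N R x ])                ≡⟨ ∑-distrib-+ {_} (λ x → [ covers N P x ]) _ ⟩
  coverage N P + coverage N R                                    ∎
  where
  open ≤-Reasoning
  [∨]+[∧] : ∀ p r → [ p ∨ r ] + [ p ∧ r ] ≤ [ p ] + [ r ]
  [∨]+[∧] false r     = ≤-reflexive (+-identityʳ _)
  [∨]+[∧] true  false = ≤-refl
  [∨]+[∧] true  true  = ≤-refl
  pointwise : ∀ x → [ covers N (P ∪ R) x ] + [ covers N (P ∩ R) x ] ≤ [ covers N P x ] + [ covers N R x ]
  pointwise x rewrite covers-∪ N P R x =
    ≤-trans (+-monoʳ-≤ [ covers N P x ∨ covers N R x ] (covers-∩ N P R x)) ([∨]+[∧] (covers N P x) _)

weight-insert : ∀ {a} (d : Fin a → ℕ) R u → lookup R u ≡ false → weight d (R [ u ]≔ true) ≡ d u + weight d R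
weight-insert d (false ∷ R) zero    _  = cong (_+ weight (d ∘ suc) R) (+-identityʳ (d zero))
weight-insert d (b ∷ R)     (suc u) eq rewrite weight-insert (d ∘ suc) R u eq =
  +-swap ([ b ] * d zero) (d (suc u)) _
  where
  +-swap : ∀ x y z → x + (y + z) ≡ y + (x + z)
  +-swap = solve-∀

covers-insert : ∀ {a s} (N : Incidence a s) R u x →
                [ covers N (R [ u ]≔ true) x ] ≤ [ N u x ∨ covers N R x ]
covers-insert N (b ∷ R) zero    x with N zero x | covers (N ∘ suc) R x
... | true  | _     = s≤s z≤n
... | false | true  = ≤-trans ([]≤1 _) (≤-reflexive (sym (cong [_] (∨-zeroʳ (b ∧ false)))))
... | false | false = z≤n
covers-insert N (b ∷ R) (suc u) x with b ∧ N zero x | covers-insert (N ∘ suc) R u x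
... | false | ih = ih
... | true  | ih = ≤-reflexive (sym (cong [_] (∨-zeroʳ (N (suc u) x))))

weight-decrement : ∀ {a} (d : Fin a → ℕ) u R → 0 < d u →
                   weight (updateAt d u pred) R + [ lookup R u ] ≡ weight d R
weight-decrement d zero    (b ∷ R) p with d zero
weight-decrement d zero    (false ∷ R) p | suc e = +-identityʳ _
weight-decrement d zero    (true ∷ R)  p | suc e =
  trans (+-comm _ 1) refl
weight-decrement d (suc u) (b ∷ R) p =
  trans (+-assoc ([ b ] * d zero) _ _) (cong ([ b ] * d zero +_) (weight-decrement (d ∘ suc) u R p))

sum-decrement : ∀ {a} (d : Fin a → ℕ) u → 0 < d u → suc (sum (updateAt d u pred)) ≡ sum d
sum-decrement d zero p with d zero
... | suc e = refl
sum-decrement d (suc u) p = trans (sym (+-suc (d zero) _)) (cong (d zero +_) (sum-decrement (d ∘ suc) u p))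

without : ∀ {a s} → Fin s → Incidence a s → Incidence a s
without x N u y = N u y ∧ not (does (x ≟ y))

covers-without : ∀ {a s} (N : Incidence a s) x R y →
                 covers (without x N) R y ≡ covers N R y ∧ not (does (x ≟ y))
covers-without N x []      y = refl
covers-without N x (b ∷ R) y rewrite covers-without (N ∘ suc) x R y
  with b | N zero y | covers (N ∘ suc) R y | not (does (x ≟ y))
... | false | _     | _     | _     = refl
... | true  | false | _     | _     = refl
... | true  | true  | false | false = refl
... | true  | true  | false | true  = refl
... | true  | true  | true  | false = refl
... | true  | true  | true  | true  = refl

coverage-without : ∀ {a s} (N : Incidence a s) x R →
                   coverage N R ≤ coverage (without x N) R + [ covers N R x ]
coverage-without N x R = begin
  coverage N R
    ≤⟨ sum-mono pointwise ⟩
  sum (λ y → [ covers (without x N) R y ] + [ covers N R x ] * δ x y)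
    ≡⟨ ∑-distrib-+ (λ y → [ covers (without x N) R y ]) _ ⟩
  coverage (without x N) R + sum (λ y → [ covers N R x ] * δ x y)
    ≡⟨ cong (coverage (without x N) R +_) (sum-*δ [ covers N R x ] x) ⟩
  coverage (without x N) R + [ covers N R x ] ∎
  where
  open ≤-Reasoning
  pointwise : ∀ y → [ covers N R y ] ≤ [ covers (without x N) R y ] + [ covers N R x ] * δ x y
  pointwise y rewrite covers-without N x R y with x ≟ y
  ... | yes refl rewrite ∧-zeroʳ (covers N R x) | δ-refl x = ≤-reflexive (sym (*-identityʳ _))
  ... | no  _    rewrite ∧-identityʳ (covers N R y) = m≤m+n _ _

owns : ∀ {a s} → (Fin s → Maybe (Fin a)) → Fin a → Fin s → ℕ
owns own u x with own x
... | nothing = 0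
... | just v  = δ u v

Ownership : ∀ {a s} → Incidence a s → (Fin a → ℕ) → Set
Ownership {a} {s} N d = ∃ λ (own : Fin s → Maybe (Fin a)) →
  (∀ x u → own x ≡ just u → N u x ≡ true) × (∀ u → d u ≤ sum (owns own u))

module _ {a s : ℕ} (N : Incidence a s) (d : Fin a → ℕ) (H : HallCondition N d) where

  Removable : Fin a → Fin s → Set
  Removable u x = N u x ≡ true × HallCondition (without x N) (updateAt d u pred)

  Tight : Fin a → Subset a → Set
  Tight u M = lookup M u ≡ false × coverage N M ≤ weight d M

  -- Suppose that giving `x` to `u` breaks Hall's condition at `R`. If `u` were in `R`, its demand
  -- would have dropped by one and its coverage by at most one; if `R` did not cover `x`, nothing
  -- would have changed. Hence `R` omits `u`, covers `x` and had no slack.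
  removable-or-blocked : ∀ u x → 0 < d u → N u x ≡ true →
                         Removable u x ⊎ ∃ λ M → Tight u M × covers N M x ≡ true
  removable-or-blocked u x p Nux
    with anySubset? (λ R → ¬? (weight (updateAt d u pred) R ≤? coverage (without x N) R))
  ... | no ¬violated = inj₁ (Nux , λ R → ≮⇒≥ λ lt → ¬violated (R , <⇒≱ lt))
  ... | yes (R , violated) with lookup R u in eqR | covers N R x in eqx
                              | weight-decrement d u R p | coverage-without N x R | ≰⇒> violated
  ...   | r | c | dec | wo | lt = inj₂ (R , split r c eqR eqx dec wo)
    where
    split : ∀ r c → lookup R u ≡ r → covers N R x ≡ c →
            weight (updateAt d u pred) R + [ r ] ≡ weight d R →
            coverage N R ≤ coverage (without x N) R + [ c ] →
            Tight u R × covers N R x ≡ true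
    split false true eqR eqx dec wo =
      (eqR , ≤-trans wo (≤-trans (≤-reflexive (+-comm _ 1)) (≤-trans lt (≤-reflexive (trans (sym (+-identityʳ _)) dec))))) , eqx
    split false false eqR eqx dec wo = contradiction (H R) (<⇒≱ (≤-<-trans (≤-trans wo (≤-reflexive (+-identityʳ _)))
      (<-≤-trans lt (≤-reflexive (trans (sym (+-identityʳ _)) dec)))))
    split true c eqR eqx dec wo = contradiction (H R) (<⇒≱ (≤-<-trans wo
      (≤-trans (s≤s (+-monoʳ-≤ _ ([]≤1 c))) (≤-trans (+-monoˡ-≤ 1 lt) (≤-reflexive dec)))))

  tight-∪ : ∀ u M R → Tight u M → Tight u R → Tight u (M ∪ R)
  tight-∪ u M R (u∉M , tM) (u∉R , tR) =
    lookup-∪ M R u u∉M u∉R ,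
    +-cancelʳ-≤ (coverage N (M ∩ R)) _ _ (begin
      coverage N (M ∪ R) + coverage N (M ∩ R) ≤⟨ coverage-submodular N M R ⟩
      coverage N M + coverage N R             ≤⟨ +-mono-≤ tM tR ⟩
      weight d M + weight d R                 ≡⟨ weight-∪-∩ d M R ⟨
      weight d (M ∪ R) + weight d (M ∩ R)     ≤⟨ +-monoʳ-≤ _ (H (M ∩ R)) ⟩
      weight d (M ∪ R) + coverage N (M ∩ R)   ∎)
    where
    open ≤-Reasoning
    lookup-∪ : ∀ {n} (P Q : Subset n) i → lookup P i ≡ false → lookup Q i ≡ false → lookup (P ∪ Q) i ≡ false
    lookup-∪ (false ∷ P) (false ∷ Q) zero    _ _ = refl
    lookup-∪ (_ ∷ P)     (_ ∷ Q)     (suc i) p q = lookup-∪ P Q i p q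

  -- The union of the tight sets blocking the individual locations is tight.
  search : ∀ u → 0 < d u → (xs : List (Fin s)) →
           (∃ (Removable u)) ⊎
           ∃ λ M → Tight u M × (∀ x → x ∈ˡ xs → N u x ≡ true → covers N M x ≡ true)
  search u p [] = inj₂ (⊥ , (lookup-⊥ u , ≤-trans (≤-reflexive coverage-⊥) z≤n) , λ x ())
    where
    lookup-⊥ : ∀ {n} (i : Fin n) → lookup ⊥ i ≡ false
    lookup-⊥ zero    = refl
    lookup-⊥ (suc i) = lookup-⊥ i
    covers-⊥ : ∀ {a} (N : Incidence a s) x → covers N ⊥ x ≡ false
    covers-⊥ {zero}  N x = refl
    covers-⊥ {suc a} N x = covers-⊥ (N ∘ suc) x
    coverage-⊥ : coverage N ⊥ ≡ 0
    coverage-⊥ = trans (sum-cong-≗ (λ x → cong [_] (covers-⊥ N x))) (trans (sum-const s 0) (*-zeroʳ s))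
  search u p (x ∷ xs) with search u p xs
  ... | inj₁ found = inj₁ found
  ... | inj₂ (M , tM , cM) with N u x in eqN
  ...   | false = inj₂ (M , tM , λ { y (here refl) Nuy → contradiction (trans (sym Nuy) eqN) λ () ; y (there q) → cM y q })
  ...   | true with removable-or-blocked u x p eqN
  ...     | inj₁ r = inj₁ (x , r)
  ...     | inj₂ (R , tR , cR) = inj₂ (M ∪ R , tight-∪ u M R tM tR , both)
    where
    both : ∀ y → y ∈ˡ (x ∷ xs) → N u y ≡ true → covers N (M ∪ R) y ≡ true
    both y (here refl) Nuy rewrite covers-∪ N M R y | cR = ∨-zeroʳ (covers N M y)
    both y (there q)   Nuy rewrite covers-∪ N M R y | cM y q Nuy = refl

  removable : ∀ u → 0 < d u → ∃ (Removable u)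
  removable u p with search u p (allFin s)
  ... | inj₁ found = found
  -- `M` already covers every cell of `u`, so adding `u` raises the demand by `d u > 0` and the
  -- coverage by nothing.
  ... | inj₂ (M , (u∉M , tM) , cM) = contradiction (H (M [ u ]≔ true)) (<⇒≱ (begin-strict
    coverage N (M [ u ]≔ true) ≤⟨ sum-mono pointwise ⟩
    coverage N M               ≤⟨ tM ⟩
    weight d M                 <⟨ m<n+m (weight d M) p ⟩
    d u + weight d M           ≡⟨ weight-insert d M u u∉M ⟨
    weight d (M [ u ]≔ true)   ∎))
    where
    open ≤-Reasoning
    pointwise : ∀ x → [ covers N (M [ u ]≔ true) x ] ≤ [ covers N M x ]
    pointwise x with N u x in eqN | covers-insert N M u x
    ... | false | le = le
    ... | true  | le rewrite cM x (∈-allFin x) eqN = le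

-- Induction on the total demand: some cell can be handed over without violating Hall's condition.
-- It is then deleted for all elements, so that it is never assigned twice.
hall : ∀ {a s} (N : Incidence a s) (d : Fin a → ℕ) → HallCondition N d → Ownership N d
hall N d = go (sum d) N d refl
  where
  go : ∀ {a s} k (N : Incidence a s) (d : Fin a → ℕ) → sum d ≡ k → HallCondition N d → Ownership N d
  go zero N d eq H = (λ _ → nothing) , (λ _ _ ()) ,
    λ u → ≤-trans (term≤sum d u) (≤-trans (≤-reflexive eq) z≤n)
  go {a} {s} (suc k) N d eq H
    with u , p ← positive-term d (subst (0 <_) (sym eq) (s≤s z≤n))
    with x , Nux , H′ ← removable N d H u p
    with own , sound , enough ← go k (without x N) (updateAt d u pred)
                                  (cong pred (trans (sum-decrement d u p) eq)) H′
    = own′ , sound′ , enough′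
    where
    own′ : Fin s → Maybe (Fin a)
    own′ y = if does (x ≟ y) then just u else own y

    x-free : ∀ v → own x ≢ just v
    x-free v q with sound x v q
    ... | r with x ≟ x
    ...   | yes _  = contradiction (trans (sym r) (∧-zeroʳ (N v x))) λ ()
    ...   | no x≢x = x≢x refl

    sound′ : ∀ y v → own′ y ≡ just v → N v y ≡ true
    sound′ y v q with x ≟ y
    ... | yes refl = subst (λ w → N w x ≡ true) (just-injective q) Nux
    ... | no x≢y   = ∧-true (sound y v q)
      where
      ∧-true : ∀ {b c} → b ∧ c ≡ true → b ≡ true
      ∧-true {true} _ = refl

    owns≤ : ∀ v y → owns own v y ≤ owns own′ v y
    owns≤ v y with x ≟ y
    ... | no _ = ≤-refl
    ... | yes refl with own x in eqo
    ...   | nothing = z≤n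
    ...   | just w  = contradiction eqo (x-free w)

    owns< : owns own u x < owns own′ u x
    owns< with x ≟ x
    ... | no x≢x = contradiction refl x≢x
    ... | yes _ with own x in eqo
    ...   | nothing = ≤-reflexive (sym (δ-refl u))
    ...   | just w  = contradiction eqo (x-free w)

    enough′ : ∀ v → d v ≤ sum (owns own′ v)
    enough′ v with v ≟ u
    ... | yes refl = ≤-trans (≤-reflexive (sym (suc-pred (d u) {{>-nonZero p}})))
                     (≤-trans (s≤s (≤-trans (≤-reflexive (sym (updateAt-updates u d))) (enough u)))
                              (sum-mono-< (owns≤ u) x owns<))
    ... | no v≢u   = ≤-trans (≤-reflexive (sym (updateAt-minimal v u d v≢u)))
                     (≤-trans (enough v) (sum-mono (owns≤ v)))

-- Sums over lists and enumeration of vectors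

private variable
  A B : Set

∑ : List A → (A → ℕ) → ℕ
∑ []       f = 0
∑ (x ∷ xs) f = f x + ∑ xs f

∑-cong : ∀ (xs : List A) {f g : A → ℕ} → (∀ x → f x ≡ g x) → ∑ xs f ≡ ∑ xs g
∑-cong []       f≡g = refl
∑-cong (x ∷ xs) f≡g = cong₂ _+_ (f≡g x) (∑-cong xs f≡g)

∑-mono : ∀ (xs : List A) {f g : A → ℕ} → (∀ x → f x ≤ g x) → ∑ xs f ≤ ∑ xs g
∑-mono []       f≤g = z≤n
∑-mono (x ∷ xs) f≤g = +-mono-≤ (f≤g x) (∑-mono xs f≤g)

∑-+ : ∀ (xs : List A) (f g : A → ℕ) → ∑ xs (λ x → f x + g x) ≡ ∑ xs f + ∑ xs g
∑-+ []       f g = refl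
∑-+ (x ∷ xs) f g = trans (cong (f x + g x +_) (∑-+ xs f g)) (lemma (f x) (g x) _ _)
  where
  lemma : ∀ w x y z → (w + x) + (y + z) ≡ (w + y) + (x + z)
  lemma = solve-∀

∑-*ˡ : ∀ (xs : List A) c (f : A → ℕ) → ∑ xs (λ x → c * f x) ≡ c * ∑ xs f
∑-*ˡ []       c f = sym (*-zeroʳ c)
∑-*ˡ (x ∷ xs) c f = trans (cong (c * f x +_) (∑-*ˡ xs c f)) (sym (*-distribˡ-+ c (f x) _))

∑-*ʳ : ∀ (xs : List A) c (f : A → ℕ) → ∑ xs (λ x → f x * c) ≡ ∑ xs f * c
∑-*ʳ []       c f = refl
∑-*ʳ (x ∷ xs) c f = trans (cong (f x * c +_) (∑-*ʳ xs c f)) (sym (*-distribʳ-+ c (f x) _))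

∑-const : ∀ (xs : List A) c → ∑ xs (λ _ → c) ≡ length xs * c
∑-const []       c = refl
∑-const (x ∷ xs) c = cong (c +_) (∑-const xs c)

∑-++ : ∀ (xs ys : List A) f → ∑ (xs ++ ys) f ≡ ∑ xs f + ∑ ys f
∑-++ []       ys f = refl
∑-++ (x ∷ xs) ys f = trans (cong (f x +_) (∑-++ xs ys f)) (sym (+-assoc (f x) _ _))

∑-map : ∀ (h : A → B) xs f → ∑ (map h xs) f ≡ ∑ xs (f ∘ h)
∑-map h []       f = refl
∑-map h (x ∷ xs) f = cong (f (h x) +_) (∑-map h xs f)

∑-swap : ∀ (xs : List A) (ys : List B) (f : A → B → ℕ) →
         ∑ xs (λ x → ∑ ys (f x)) ≡ ∑ ys (λ y → ∑ xs (λ x → f x y))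
∑-swap []       ys f = sym (trans (∑-const ys 0) (*-zeroʳ (length ys)))
∑-swap (x ∷ xs) ys f = trans (cong (∑ ys (f x) +_) (∑-swap xs ys f)) (sym (∑-+ ys (f x) _))

∑-cartesian : ∀ {C : Set} (h : A → B → C) xs ys f →
              ∑ (cartesianProductWith h xs ys) f ≡ ∑ xs (λ x → ∑ ys (λ y → f (h x y)))
∑-cartesian h []       ys f = refl
∑-cartesian h (x ∷ xs) ys f =
  trans (∑-++ (map (h x) ys) _ f) (cong₂ _+_ (∑-map (h x) ys f) (∑-cartesian h xs ys f))

∑-tabulate : ∀ {n} (g : Fin n → A) f → ∑ (tabulate g) f ≡ sum (f ∘ g)
∑-tabulate {n = zero}  g f = refl
∑-tabulate {n = suc n} g f = cong (f (g zero) +_) (∑-tabulate (g ∘ suc) f)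

term≤∑ : ∀ {xs : List A} (f : A → ℕ) {x} → x ∈ˡ xs → f x ≤ ∑ xs f
term≤∑ f (here refl) = m≤m+n _ _
term≤∑ f (there p)   = ≤-trans (term≤∑ f p) (m≤n+m _ _)

-- The probabilistic method in counting form: fewer than one bad event on average leaves a
-- configuration without any.
∑-zero-term : ∀ (xs : List A) f → ∑ xs f < length xs → ∃ λ x → f x ≡ 0
∑-zero-term (x ∷ xs) f lt with f x in eq
... | zero  = x , eq
... | suc y = ∑-zero-term xs f (≤-trans (s≤s (m≤n+m _ y)) (pred-mono-≤ lt))

vectors : List A → ∀ n → List (Vec A n)
vectors xs zero    = [] ∷ []
vectors xs (suc n) = cartesianProductWith _∷_ xs (vectors xs n)

length-vectors : ∀ (xs : List A) n → length (vectors xs n) ≡ length xs ^ n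
length-vectors xs zero    = refl
length-vectors xs (suc n) = trans (length≡∑ (vectors xs (suc n)))
  (trans (∑-cartesian _∷_ xs (vectors xs n) (λ _ → 1))
  (trans (∑-const xs _)
  (cong (length xs *_) (trans (sym (length≡∑ (vectors xs n))) (length-vectors xs n)))))
  where
  length≡∑ : ∀ {X : Set} (ys : List X) → length ys ≡ ∑ ys (λ _ → 1)
  length≡∑ ys = sym (trans (∑-const ys 1) (*-identityʳ _))

∈-vectors : ∀ {xs : List A} → (∀ x → x ∈ˡ xs) → ∀ {n} (v : Vec A n) → v ∈ˡ vectors xs n
∈-vectors all []      = here refl
∈-vectors all (x ∷ v) = ∈-cartesianProductWith⁺ _∷_ (all x) (∈-vectors all v)

-- Independence of the slots of a random row: the sum of products factors into a product of sums.
∑-prod : ∀ {s} B L (w : Fin L → Fin s → ℕ) → (∀ z → ∑ (allFin s) (w z) ≤ B) →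
         ∑ (vectors (allFin s) L) (λ r → prod (λ z → w z (lookup r z))) ≤ B ^ L
∑-prod     B zero    w w≤B = ≤-refl
∑-prod {s} B (suc L) w w≤B = begin
  ∑ (vectors (allFin s) (suc L)) (λ r → prod (λ z → w z (lookup r z)))
    ≡⟨ ∑-cartesian _∷_ (allFin s) _ _ ⟩
  ∑ (allFin s) (λ c → ∑ (vectors (allFin s) L) (λ r → w zero c * prod (λ z → w (suc z) (lookup r z))))
    ≡⟨ ∑-cong (allFin s) (λ c → ∑-*ˡ (vectors (allFin s) L) (w zero c) _) ⟩
  ∑ (allFin s) (λ c → w zero c * ∑ (vectors (allFin s) L) (λ r → prod (λ z → w (suc z) (lookup r z))))
    ≡⟨ ∑-*ʳ (allFin s) _ (w zero) ⟩
  ∑ (allFin s) (w zero) * ∑ (vectors (allFin s) L) (λ r → prod (λ z → w (suc z) (lookup r z)))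
    ≤⟨ *-mono-≤ (w≤B zero) (∑-prod B L (w ∘ suc) (w≤B ∘ suc)) ⟩
  B * B ^ L ∎
  where open ≤-Reasoning

^-distribʳ-* : ∀ n x y → (x * y) ^ n ≡ x ^ n * y ^ n
^-distribʳ-* zero    x y = refl
^-distribʳ-* (suc n) x y = trans (cong (x * y *_) (^-distribʳ-* n x y)) (shuffle x y (x ^ n) (y ^ n))
  where
  shuffle : ∀ a b c d → a * b * (c * d) ≡ (a * c) * (b * d)
  shuffle = solve-∀

indicator-≤ : ∀ {P : Set} {c b} (p? : Dec P) → (P → c ≤ b) → [ does p? ] * c ≤ b
indicator-≤ (yes p) c≤b = ≤-trans (≤-reflexive (+-identityʳ _)) (c≤b p)
indicator-≤ (no _)  c≤b = z≤n

-- Random rows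

Row : ℕ → ℕ → Set
Row L s = Vec (Fin s) L

rows : ∀ L s → List (Row L s)
rows L s = vectors (allFin s) L

length-rows : ∀ L s → length (rows L s) ≡ s ^ L
length-rows L s = trans (length-vectors (allFin s) L) (cong (_^ L) (length-tabulate {n = s} (λ i → i)))

selected : ∀ {m} → Subset m → Vec A m → List A
selected []          []      = []
selected (false ∷ Y) (r ∷ G) = selected Y G
selected (true ∷ Y)  (r ∷ G) = r ∷ selected Y G

length-selected : ∀ {m} (Y : Subset m) (G : Vec A m) → length (selected Y G) ≡ ∣ Y ∣
length-selected []          []      = refl
length-selected (false ∷ Y) (r ∷ G) = length-selected Y G
length-selected (true ∷ Y)  (r ∷ G) = cong suc (length-selected Y G)

positive : ℕ → ℕ
positive zero    = 0
positive (suc _) = 1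

isZero : ℕ → ℕ
isZero zero    = 1
isZero (suc _) = 0

module _ {L s : ℕ} where

  -- Multiplicities are kept so that the total over the cells of a slot is exactly the number of
  -- rows; they bound the collision indicator from above.
  mult : List (Row L s) → Fin L → Fin s → ℕ
  mult []       z c = 0
  mult (r ∷ rs) z c = δ (lookup r z) c + mult rs z c

  ∑-mult : ∀ rs z → ∑ (allFin s) (mult rs z) ≡ length rs
  ∑-mult []       z = trans (∑-const (allFin s) 0) (*-zeroʳ (length (allFin s)))
  ∑-mult (r ∷ rs) z = trans (∑-+ (allFin s) (δ (lookup r z)) (mult rs z))
    (cong₂ _+_ (trans (∑-tabulate (λ i → i) (δ (lookup r z))) (sum-δ (lookup r z))) (∑-mult rs z))

  hits : List (Row L s) → Row L s → ℕ
  hits D r = sum (λ z → positive (mult D z (lookup r z)))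

  fresh : List (Row L s) → Row L s → ℕ
  fresh rs r = sum (λ z → isZero (mult rs z (lookup r z)))

  -- Each row contributes the cells not met in the later selected rows, so every touched cell counts
  -- once. This sequential form of the coverage suits revealing the rows one at a time.
  new : ∀ {m} → Subset m → Vec (Row L s) m → ℕ
  new []          []      = 0
  new (false ∷ Y) (r ∷ G) = new Y G
  new (true ∷ Y)  (r ∷ G) = fresh (selected Y G) r + new Y G

  module Moment (α β γ : ℕ) (D : List (Row L s)) where

    slotWeight : List (Row L s) → Fin L → Fin s → ℕ
    slotWeight rs z c = γ + α * mult D z c + β * mult rs z c

    rowWeight : List (Row L s) → Row L s → ℕ
    rowWeight rs r = prod (λ z → slotWeight rs z (lookup r z))

    -- A generating function of collisions: `α` rewards a hit on `D`, `β` a repeat. A row is weighed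
    -- against the later rows only, so that it can be summed out while those stay fixed.
    moment : ∀ {m} → Subset m → Vec (Row L s) m → ℕ
    moment []          []      = 1
    moment (false ∷ Y) (r ∷ G) = moment Y G
    moment (true ∷ Y)  (r ∷ G) = moment Y G * rowWeight (selected Y G) r

    ∑-slotWeight : ∀ rs z → ∑ (allFin s) (slotWeight rs z) ≡ s * γ + α * length D + β * length rs
    ∑-slotWeight rs z =
      trans (∑-+ (allFin s) (λ c → γ + α * mult D z c) _)
        (cong₂ _+_
          (trans (∑-+ (allFin s) (λ _ → γ) _)
            (cong₂ _+_ (trans (∑-const (allFin s) γ) (cong (_* γ) (length-tabulate {n = s} (λ i → i))))
                       (trans (∑-*ˡ (allFin s) α _) (cong (α *_) (∑-mult D z)))))
          (trans (∑-*ˡ (allFin s) β _) (cong (β *_) (∑-mult rs z))))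

    -- With the later rows fixed, the hypothesis bounds the sum of each slot weight of the first row
    -- by `c * s`, and the slots are independent; the remaining rows follow by recursion.
    ∑-moment : ∀ c g → s * γ + α * length D + β * g ≤ c * s → ∀ {m} (Y : Subset m) → ∣ Y ∣ ≤ g →
               ∑ (vectors (rows L s) m) (moment Y) ≤ c ^ (L * ∣ Y ∣) * (s ^ L) ^ m
    ∑-moment c g le [] _ rewrite *-zeroʳ L = ≤-refl
    ∑-moment c g le {suc m} (false ∷ Y) Y≤g = begin
      ∑ (vectors (rows L s) (suc m)) (moment (false ∷ Y))
        ≡⟨ ∑-cartesian _∷_ (rows L s) _ _ ⟩
      ∑ (rows L s) (λ _ → ∑ (vectors (rows L s) m) (moment Y))
        ≡⟨ trans (∑-const (rows L s) _) (cong (_* ∑ (vectors (rows L s) m) (moment Y)) (length-rows L s)) ⟩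
      s ^ L * ∑ (vectors (rows L s) m) (moment Y)
        ≤⟨ *-monoʳ-≤ (s ^ L) (∑-moment c g le Y Y≤g) ⟩
      s ^ L * (c ^ (L * ∣ Y ∣) * (s ^ L) ^ m)
        ≡⟨ lemma (s ^ L) (c ^ (L * ∣ Y ∣)) ((s ^ L) ^ m) ⟩
      c ^ (L * ∣ Y ∣) * (s ^ L) ^ suc m ∎
      where
      open ≤-Reasoning
      lemma : ∀ x y z → x * (y * z) ≡ y * (x * z)
      lemma = solve-∀
    ∑-moment c g le {suc m} (true ∷ Y) Y≤g = begin
      ∑ (vectors (rows L s) (suc m)) (moment (true ∷ Y))
        ≡⟨ ∑-cartesian _∷_ (rows L s) _ _ ⟩
      ∑ (rows L s) (λ r → ∑ (vectors (rows L s) m) (λ G → moment Y G * rowWeight (selected Y G) r))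
        ≡⟨ ∑-swap (rows L s) (vectors (rows L s) m) _ ⟩
      ∑ (vectors (rows L s) m) (λ G → ∑ (rows L s) (λ r → moment Y G * rowWeight (selected Y G) r))
        ≡⟨ ∑-cong (vectors (rows L s) m) (λ G → ∑-*ˡ (rows L s) (moment Y G) _) ⟩
      ∑ (vectors (rows L s) m) (λ G → moment Y G * ∑ (rows L s) (rowWeight (selected Y G)))
        ≤⟨ ∑-mono (vectors (rows L s) m) (λ G → *-monoʳ-≤ (moment Y G)
             (∑-prod (c * s) L (slotWeight (selected Y G)) (λ z → ≤-trans (≤-reflexive (∑-slotWeight (selected Y G) z))
               (≤-trans (+-monoʳ-≤ (s * γ + α * length D) (*-monoʳ-≤ β (tail≤g G))) le)))) ⟩
      ∑ (vectors (rows L s) m) (λ G → moment Y G * (c * s) ^ L)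
        ≡⟨ ∑-*ʳ (vectors (rows L s) m) _ (moment Y) ⟩
      ∑ (vectors (rows L s) m) (moment Y) * (c * s) ^ L
        ≤⟨ *-monoˡ-≤ ((c * s) ^ L) (∑-moment c g le Y (≤-trans (n≤1+n _) Y≤g)) ⟩
      c ^ (L * ∣ Y ∣) * (s ^ L) ^ m * (c * s) ^ L
        ≡⟨ cong (c ^ (L * ∣ Y ∣) * (s ^ L) ^ m *_) (^-distribʳ-* L c s) ⟩
      c ^ (L * ∣ Y ∣) * (s ^ L) ^ m * (c ^ L * s ^ L)
        ≡⟨ lemma (c ^ (L * ∣ Y ∣)) ((s ^ L) ^ m) (c ^ L) (s ^ L) ⟩
      (c ^ L * c ^ (L * ∣ Y ∣)) * (s ^ L * (s ^ L) ^ m)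
        ≡⟨ cong (_* (s ^ L * (s ^ L) ^ m)) (trans (sym (^-distribˡ-+-* c L _)) (cong (c ^_) (sym (*-suc L ∣ Y ∣)))) ⟩
      c ^ (L * suc ∣ Y ∣) * (s ^ L) ^ suc m ∎
      where
      open ≤-Reasoning
      lemma : ∀ a b c d → a * b * (c * d) ≡ (c * a) * (d * b)
      lemma = solve-∀
      tail≤g : ∀ G → length (selected Y G) ≤ g
      tail≤g G = ≤-trans (≤-reflexive (length-selected Y G)) (≤-trans (n≤1+n _) Y≤g)

    -- A slot counts towards h if it hits D, towards j if it repeats, and towards f if it does neither.
    record Exponents (slots hit unseen bound β′ : ℕ) : Set where
      constructor exponents
      field
        h j f   : ℕ
        total   : h + j + f ≡ slots
        hit≤h   : hit ≤ h
        f≤unseen : f ≤ unseen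
        lower   : α ^ h * β′ ^ j * γ ^ f ≤ bound

    slots-exponents : ∀ {n} (a e : Fin n → ℕ) →
      Exponents n (sum (positive ∘ a)) (sum (isZero ∘ e)) (prod (λ z → γ + α * a z + β * e z)) (β ⊔ γ)
    slots-exponents {zero}  a e = exponents 0 0 0 refl z≤n z≤n ≤-refl
    slots-exponents {suc n} a e with slots-exponents (a ∘ suc) (e ∘ suc) | a zero | e zero
    ... | exponents h j f t hit un low | suc a₀ | e₀ =
      exponents (suc h) j f (cong suc t) (s≤s hit) (≤-trans un (m≤n+m _ _))
        (≤-trans (≤-reflexive (assoc α (α ^ h) ((β ⊔ γ) ^ j) (γ ^ f))) (*-mono-≤ α≤ low))
      where
      assoc : ∀ x y z w → x * y * z * w ≡ x * (y * z * w)
      assoc = solve-∀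
      α≤ : α ≤ γ + α * suc a₀ + β * e₀
      α≤ = ≤-trans (m≤m*n α (suc a₀)) (≤-trans (m≤n+m _ γ) (m≤m+n _ _))
    ... | exponents h j f t hit un low | zero | suc e₀ =
      exponents h (suc j) f (trans (suc-middle h j f) (cong suc t)) hit un
        (≤-trans (≤-reflexive (assoc (β ⊔ γ) (α ^ h) ((β ⊔ γ) ^ j) (γ ^ f))) (*-mono-≤ β⊔γ≤ low))
      where
      suc-middle : ∀ x y z → x + suc y + z ≡ suc (x + y + z)
      suc-middle = solve-∀
      assoc : ∀ x y z w → y * (x * z) * w ≡ x * (y * z * w)
      assoc = solve-∀
      β⊔γ≤ : β ⊔ γ ≤ γ + α * 0 + β * suc e₀
      β⊔γ≤ = ⊔-lub (≤-trans (m≤m*n β (suc e₀)) (m≤n+m _ _)) (≤-trans (m≤m+n γ (α * 0)) (m≤m+n _ _))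
    ... | exponents h j f t hit un low | zero | zero =
      exponents h j (suc f) (trans (+-suc (h + j) f) (cong suc t)) hit (s≤s un)
        (≤-trans (≤-reflexive (assoc γ (α ^ h) ((β ⊔ γ) ^ j) (γ ^ f))) (*-mono-≤ γ≤ low))
      where
      assoc : ∀ x y z w → y * z * (x * w) ≡ x * (y * z * w)
      assoc = solve-∀
      γ≤ : γ ≤ γ + α * 0 + β * 0
      γ≤ = ≤-trans (m≤m+n γ (α * 0)) (m≤m+n _ _)

    moment-exponents : ∀ K {m} (Y : Subset m) (G : Vec (Row L s) m) → All (λ r → K ≤ hits D r) (selected Y G) →
      Exponents (L * ∣ Y ∣) (K * ∣ Y ∣) (new Y G) (moment Y G) (β ⊔ γ)
    moment-exponents K []          []      [] = exponents 0 0 0 (sym (*-zeroʳ L)) (≤-reflexive (*-zeroʳ K)) z≤n ≤-refl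
    moment-exponents K (false ∷ Y) (r ∷ G) ps = moment-exponents K Y G ps
    moment-exponents K (true ∷ Y)  (r ∷ G) (p ∷ ps)
      with exponents h j f t hit un low ← slots-exponents (λ z → mult D z (lookup r z)) (λ z → mult (selected Y G) z (lookup r z))
      with exponents h′ j′ f′ t′ hit′ un′ low′ ← moment-exponents K Y G ps =
      exponents (h + h′) (j + j′) (f + f′)
        (trans (+-shuffle h h′ j j′ f f′) (trans (cong₂ _+_ t t′) (sym (*-suc L ∣ Y ∣))))
        (≤-trans (≤-reflexive (*-suc K ∣ Y ∣)) (+-mono-≤ (≤-trans p hit) hit′))
        (+-mono-≤ un un′)
        (begin
          α ^ (h + h′) * (β ⊔ γ) ^ (j + j′) * γ ^ (f + f′)
            ≡⟨ cong₂ _*_ (cong₂ _*_ (^-distribˡ-+-* α h h′) (^-distribˡ-+-* (β ⊔ γ) j j′)) (^-distribˡ-+-* γ f f′) ⟩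
          α ^ h * α ^ h′ * ((β ⊔ γ) ^ j * (β ⊔ γ) ^ j′) * (γ ^ f * γ ^ f′)
            ≡⟨ *-shuffle (α ^ h) (α ^ h′) ((β ⊔ γ) ^ j) ((β ⊔ γ) ^ j′) (γ ^ f) (γ ^ f′) ⟩
          α ^ h′ * (β ⊔ γ) ^ j′ * γ ^ f′ * (α ^ h * (β ⊔ γ) ^ j * γ ^ f)
            ≤⟨ *-mono-≤ low′ low ⟩
          moment Y G * rowWeight (selected Y G) r ∎)
      where
      open ≤-Reasoning
      +-shuffle : ∀ a a′ b b′ c c′ → a + a′ + (b + b′) + (c + c′) ≡ (a + b + c) + (a′ + b′ + c′)
      +-shuffle = solve-∀
      *-shuffle : ∀ a a′ b b′ c c′ → a * a′ * (b * b′) * (c * c′) ≡ (a′ * b′ * c′) * (a * b * c)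
      *-shuffle = solve-∀

    module _ (β≤α : β ≤ α) (γ≤α : γ ≤ α) where

      -- An exchange argument. Passing from the prescribed exponents to the actual ones turns unseen
      -- slots into repeats and repeats into hits, and neither move lowers the product. The first
      -- move is why repeats carry the base `β ⊔ γ`: in the application β : γ is s : g, which may be
      -- less than 1.
      moment-lower : ∀ K j₀ f₀ {m} (Y : Subset m) G → All (λ r → K ≤ hits D r) (selected Y G) →
                     K * ∣ Y ∣ + j₀ + f₀ ≡ L * ∣ Y ∣ → new Y G ≤ f₀ →
                     α ^ (K * ∣ Y ∣) * β ^ j₀ * γ ^ f₀ ≤ moment Y G
      moment-lower K j₀ f₀ Y G ps eq new≤f₀
        with exponents h j f t hit un low ← moment-exponents K Y G ps
        with x , refl ← m≤n⇒∃[o]m+o≡n hit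
        with y , refl ← m≤n⇒∃[o]m+o≡n (≤-trans un new≤f₀) = begin
          α ^ i * β ^ j₀ * γ ^ (f + y)
            ≡⟨ cong (α ^ i * β ^ j₀ *_) (^-distribˡ-+-* γ f y) ⟩
          α ^ i * β ^ j₀ * (γ ^ f * γ ^ y)
            ≤⟨ *-mono-≤ (*-monoʳ-≤ (α ^ i) (^-monoˡ-≤ j₀ (m≤m⊔n β γ))) (*-monoʳ-≤ (γ ^ f) (^-monoˡ-≤ y (m≤n⊔m β γ))) ⟩
          α ^ i * β′ ^ j₀ * (γ ^ f * β′ ^ y)
            ≡⟨ shuffle₁ (α ^ i) (β′ ^ j₀) (γ ^ f) (β′ ^ y) ⟩
          α ^ i * (β′ ^ j₀ * β′ ^ y) * γ ^ f
            ≡⟨ cong (λ e → α ^ i * e * γ ^ f) (trans (sym (^-distribˡ-+-* β′ j₀ y)) (trans (cong (β′ ^_) j₀+y) (^-distribˡ-+-* β′ x j))) ⟩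
          α ^ i * (β′ ^ x * β′ ^ j) * γ ^ f
            ≤⟨ *-monoˡ-≤ (γ ^ f) (*-monoʳ-≤ (α ^ i) (*-monoˡ-≤ (β′ ^ j) (^-monoˡ-≤ x (⊔-lub β≤α γ≤α)))) ⟩
          α ^ i * (α ^ x * β′ ^ j) * γ ^ f
            ≡⟨ cong (_* γ ^ f) (sym (*-assoc (α ^ i) (α ^ x) (β′ ^ j))) ⟩
          α ^ i * α ^ x * β′ ^ j * γ ^ f
            ≡⟨ cong (λ e → e * β′ ^ j * γ ^ f) (^-distribˡ-+-* α i x) ⟨
          α ^ (i + x) * β′ ^ j * γ ^ f
            ≤⟨ low ⟩
          moment Y G ∎
        where
        open ≤-Reasoning
        i = K * ∣ Y ∣
        β′ = β ⊔ γ
        shuffle₁ : ∀ a b c d → a * b * (c * d) ≡ a * (b * d) * c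
        shuffle₁ = solve-∀
        +-lemma₁ : ∀ i j f y → i + j + (f + y) ≡ (j + y) + (i + f)
        +-lemma₁ = solve-∀
        +-lemma₂ : ∀ i x j f → i + x + j + f ≡ (x + j) + (i + f)
        +-lemma₂ = solve-∀
        j₀+y : j₀ + y ≡ x + j
        j₀+y = +-cancelʳ-≡ (i + f) (j₀ + y) (x + j)
          (trans (sym (+-lemma₁ i j₀ f y)) (trans eq (trans (sym t) (+-lemma₂ i x j f))))

  Crowded : (K f₀ : ℕ) (D : List (Row L s)) → ∀ {m} → Subset m → Vec (Row L s) m → Set
  Crowded K f₀ D Y G = All (λ r → K ≤ hits D r) (selected Y G) × new Y G ≤ f₀

  crowded? : ∀ K f₀ D {m} (Y : Subset m) G → Dec (Crowded K f₀ D Y G)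
  crowded? K f₀ D Y G = all? (λ r → K ≤? hits D r) (selected Y G) ×-dec (new Y G ≤? f₀)

  crowdedCount : (K f₀ : ℕ) (D : List (Row L s)) → ∀ {m} → Subset m → ℕ
  crowdedCount K f₀ D {m} Y = ∑ (vectors (rows L s) m) (λ G → [ does (crowded? K f₀ D Y G) ])

  -- Markov's inequality for the moment with α : β : γ = s/n : s/g : 1, scaled by n * g.
  crowdedCount-bound : ∀ K j f {m} (Y : Subset m) n D → 1 ≤ n → n ≤ s → n ≤ ∣ Y ∣ → length D ≤ n →
    K * ∣ Y ∣ + j + f ≡ L * ∣ Y ∣ →
    crowdedCount K f D Y * s ^ (K * ∣ Y ∣ + j) ≤
      3 ^ (L * ∣ Y ∣) * n ^ (K * ∣ Y ∣) * ∣ Y ∣ ^ j * (s ^ L) ^ m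
  crowdedCount-bound K j f {m} Y n D 1≤n n≤s n≤g D≤n eq = *-cancelʳ-≤ _ _ (g ^ i * n ^ j * (n * g) ^ f) {{>-nonZero c>0}} (begin
    cnt * s ^ (i + j) * (g ^ i * n ^ j * (n * g) ^ f)
      ≡⟨ cong (λ e → cnt * e * (g ^ i * n ^ j * (n * g) ^ f)) (^-distribˡ-+-* s i j) ⟩
    cnt * (s ^ i * s ^ j) * (g ^ i * n ^ j * (n * g) ^ f)
      ≡⟨ shuffle₁ cnt (s ^ i) (s ^ j) (g ^ i) (n ^ j) ((n * g) ^ f) ⟩
    cnt * ((s ^ i * g ^ i) * (s ^ j * n ^ j) * (n * g) ^ f)
      ≡⟨ cong₂ (λ u v → cnt * (u * v * (n * g) ^ f)) (sym (^-distribʳ-* i s g)) (sym (^-distribʳ-* j s n)) ⟩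
    cnt * ((s * g) ^ i * (s * n) ^ j * (n * g) ^ f)
      ≡⟨ ∑-*ʳ (vectors (rows L s) m) _ _ ⟨
    ∑ (vectors (rows L s) m) (λ G → [ does (crowded? K f D Y G) ] * ((s * g) ^ i * (s * n) ^ j * (n * g) ^ f))
      ≤⟨ ∑-mono (vectors (rows L s) m) markov ⟩
    ∑ (vectors (rows L s) m) (moment Y)
      ≤⟨ ∑-moment (3 * (n * g)) g slots≤ Y ≤-refl ⟩
    (3 * (n * g)) ^ (L * g) * (s ^ L) ^ m
      ≡⟨ cong (_* (s ^ L) ^ m) (trans (^-distribʳ-* (L * g) 3 (n * g)) (cong (3 ^ (L * g) *_) split)) ⟩
    3 ^ (L * g) * ((n ^ i * g ^ i) * (n ^ j * g ^ j) * (n * g) ^ f) * (s ^ L) ^ m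
      ≡⟨ shuffle₂ (3 ^ (L * g)) (n ^ i) (g ^ i) (n ^ j) (g ^ j) ((n * g) ^ f) ((s ^ L) ^ m) ⟩
    3 ^ (L * g) * n ^ i * g ^ j * (s ^ L) ^ m * (g ^ i * n ^ j * (n * g) ^ f) ∎)
    where
    open ≤-Reasoning
    g = ∣ Y ∣
    i = K * g
    cnt = crowdedCount K f D Y
    open Moment (s * g) (s * n) (n * g) D
    1≤g : 1 ≤ g
    1≤g = ≤-trans 1≤n n≤g
    pos : ∀ {x} → 1 ≤ x → ∀ k → 0 < x ^ k
    pos p k = m^n>0 _ {{>-nonZero p}} k
    c>0 : 0 < g ^ i * n ^ j * (n * g) ^ f
    c>0 = *-mono-≤ (*-mono-≤ (pos 1≤g i) (pos 1≤n j)) (pos (*-mono-≤ 1≤n 1≤g) f)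
    shuffle₁ : ∀ c a b a′ b′ e → c * (a * b) * (a′ * b′ * e) ≡ c * ((a * a′) * (b * b′) * e)
    shuffle₁ = solve-∀
    shuffle₂ : ∀ t a b c d e w → t * ((a * b) * (c * d) * e) * w ≡ t * a * d * w * (b * c * e)
    shuffle₂ = solve-∀
    split : (n * g) ^ (L * g) ≡ (n ^ i * g ^ i) * (n ^ j * g ^ j) * (n * g) ^ f
    split = trans (cong ((n * g) ^_) (sym eq)) (trans (^-distribˡ-+-* (n * g) (i + j) f)
      (cong (_* (n * g) ^ f) (trans (^-distribˡ-+-* (n * g) i j) (cong₂ _*_ (^-distribʳ-* i n g) (^-distribʳ-* j n g)))))
    markov : ∀ G → [ does (crowded? K f D Y G) ] * ((s * g) ^ i * (s * n) ^ j * (n * g) ^ f) ≤ moment Y G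
    markov G = indicator-≤ (crowded? K f D Y G)
      (λ (ps , new≤f) → moment-lower (*-monoʳ-≤ s n≤g) (*-monoˡ-≤ g n≤s) K j f Y G ps eq new≤f)
    -- The weights are balanced: each of the three contributions is at most `s * n * g`, whence the
    -- base 3.
    slots≤ : s * (n * g) + s * g * length D + s * n * g ≤ 3 * (n * g) * s
    slots≤ = ≤-trans (+-monoˡ-≤ (s * n * g) (+-monoʳ-≤ (s * (n * g)) (*-monoʳ-≤ (s * g) D≤n))) (≤-reflexive (triple s n g))
      where
      triple : ∀ s n g → s * (n * g) + s * g * n + s * n * g ≡ 3 * (n * g) * s
      triple = solve-∀

-- Union bound over subsets

subsets : ∀ m → List (Subset m)
subsets = vectors (false ∷ true ∷ [])

∈-subsets : ∀ {m} (Y : Subset m) → Y ∈ˡ subsets m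
∈-subsets = ∈-vectors λ { false → here refl ; true → there (here refl) }

∑-subsets : ∀ m (q : ℕ → ℕ) →
            ∑ (subsets m) (λ Y → q ∣ Y ∣) ≤ sum {suc m} (λ r → (m C toℕ r) * q (toℕ r))
∑-subsets zero    q = ≤-reflexive (cong (_+ 0) (sym (*-identityˡ (q 0))))
∑-subsets (suc m) q = begin
  ∑ (subsets (suc m)) (λ Y → q ∣ Y ∣)
    ≡⟨ ∑-cartesian _∷_ (false ∷ true ∷ []) (subsets m) _ ⟩
  ∑ (subsets m) (λ Y → q ∣ Y ∣) + (∑ (subsets m) (λ Y → q (suc ∣ Y ∣)) + 0)
    ≤⟨ +-mono-≤ (∑-subsets m q) (+-monoˡ-≤ 0 (∑-subsets m (q ∘ suc))) ⟩
  (1 * q 0 + sum {m} (λ r → (m C suc (toℕ r)) * q (suc (toℕ r)))) + (sum {suc m} (λ r → (m C toℕ r) * q (suc (toℕ r))) + 0)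
    ≤⟨ +-monoˡ-≤ _ (+-monoʳ-≤ (1 * q 0) (drop-last m (λ r → (m C suc r) * q (suc r)))) ⟩
  (1 * q 0 + sum {suc m} (λ r → (m C suc (toℕ r)) * q (suc (toℕ r)))) + (sum {suc m} (λ r → (m C toℕ r) * q (suc (toℕ r))) + 0)
    ≡⟨ regroup (1 * q 0) (sum {suc m} (λ r → (m C suc (toℕ r)) * q (suc (toℕ r)))) _ ⟩
  1 * q 0 + (sum {suc m} (λ r → (m C toℕ r) * q (suc (toℕ r))) + sum {suc m} (λ r → (m C suc (toℕ r)) * q (suc (toℕ r))))
    ≡⟨ cong (1 * q 0 +_) (sym (∑-distrib-+ {suc m} (λ r → (m C toℕ r) * q (suc (toℕ r))) (λ r → (m C suc (toℕ r)) * q (suc (toℕ r))))) ⟩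
  1 * q 0 + sum {suc m} (λ r → (m C toℕ r) * q (suc (toℕ r)) + (m C suc (toℕ r)) * q (suc (toℕ r)))
    ≤⟨ +-monoʳ-≤ (1 * q 0) (sum-mono {suc m} (λ r → ≤-reflexive (pascal (toℕ r)))) ⟩
  sum {suc (suc m)} (λ r → (suc m C toℕ r) * q (toℕ r)) ∎
  where
  open ≤-Reasoning
  drop-last : ∀ m (f : ℕ → ℕ) → sum {m} (f ∘ toℕ) ≤ sum {suc m} (f ∘ toℕ)
  drop-last zero    f = z≤n
  drop-last (suc m) f = +-monoʳ-≤ (f 0) (drop-last m (f ∘ suc))
  regroup : ∀ a b c → (a + b) + (c + 0) ≡ a + (c + b)
  regroup = solve-∀
  pascal : ∀ r → (m C r) * q (suc r) + (m C suc r) * q (suc r) ≡ (suc m C suc r) * q (suc r)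
  pascal r = trans (sym (*-distribʳ-+ (q (suc r)) (m C r) (m C suc r))) (cong (_* q (suc r)) (nCk+nC[k+1]≡[n+1]C[k+1] m r))

nCk*k!≤n^k : ∀ n k → (n C k) * k ! ≤ n ^ k
nCk*k!≤n^k n       zero    = ≤-refl
nCk*k!≤n^k zero    (suc k) rewrite k>n⇒nCk≡0 {0} {suc k} (s≤s z≤n) = z≤n
nCk*k!≤n^k (suc n) (suc k) = begin
  (suc n C suc k) * (suc k) !                              ≡⟨ cong (_* (suc k) !) (sym (nCk+nC[k+1]≡[n+1]C[k+1] n k)) ⟩
  ((n C k) + (n C suc k)) * (suc k * k !)                  ≡⟨ expand (n C k) (n C suc k) (suc k) (k !) ⟩
  suc k * ((n C k) * k !) + (n C suc k) * (suc k * k !)    ≤⟨ +-mono-≤ (*-monoʳ-≤ (suc k) (nCk*k!≤n^k n k)) (nCk*k!≤n^k n (suc k)) ⟩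
  suc k * n ^ k + n ^ suc k                                ≤⟨ bernoulli k ⟩
  suc n ^ suc k                                            ∎
  where
  open ≤-Reasoning
  expand : ∀ a b c d → (a + b) * (c * d) ≡ c * (a * d) + b * (c * d)
  expand = solve-∀
  bernoulli : ∀ k → suc k * n ^ k + n ^ suc k ≤ suc n ^ suc k
  bernoulli zero    = ≤-refl
  bernoulli (suc k) = begin
    suc (suc k) * n ^ suc k + n ^ suc (suc k)             ≤⟨ m≤m+n _ (suc k * n ^ k) ⟩
    suc (suc k) * n ^ suc k + n ^ suc (suc k) + suc k * n ^ k ≡⟨ step n k (n ^ k) ⟩
    suc n * (suc k * n ^ k + n ^ suc k)                   ≤⟨ *-monoʳ-≤ (suc n) (bernoulli k) ⟩
    suc n ^ suc (suc k)                                   ∎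
    where
    step : ∀ n k p → suc (suc k) * (n * p) + n * (n * p) + suc k * p ≡ suc n * (suc k * p + n * p)
    step = solve-∀

-- Both sides compare with (2r)!.
r^r≤4^r*r! : ∀ r → r ^ r ≤ 4 ^ r * r !
r^r≤4^r*r! r = *-cancelʳ-≤ _ _ (r !) {{r !≢0}} (begin
  r ^ r * r !        ≤⟨ rising r ⟩
  (r + r) !          ≤⟨ central r ⟩
  4 ^ r * (r ! * r !) ≡⟨ *-assoc (4 ^ r) (r !) (r !) ⟨
  4 ^ r * r ! * r !  ∎)
  where
  open ≤-Reasoning
  rising : ∀ j → r ^ j * r ! ≤ (j + r) !
  rising zero    = ≤-reflexive (+-identityʳ (r !))
  rising (suc j) = ≤-trans (≤-reflexive (*-assoc r (r ^ j) (r !)))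
    (*-mono-≤ (≤-trans (m≤n+m r j) (n≤1+n _)) (rising j))
  central : ∀ r → (r + r) ! ≤ 4 ^ r * (r ! * r !)
  central zero    = s≤s z≤n
  central (suc r) = begin
    suc (r + suc r) * (r + suc r) !                       ≡⟨ cong (λ x → suc x * x !) (+-suc r r) ⟩
    suc (suc (r + r)) * (suc (r + r) * (r + r) !)         ≤⟨ *-monoʳ-≤ (suc (suc (r + r))) (*-mono-≤ (n≤1+n (suc (r + r))) (central r)) ⟩
    suc (suc (r + r)) * (suc (suc (r + r)) * (4 ^ r * (r ! * r !))) ≡⟨ step r (4 ^ r) (r !) ⟩
    4 ^ suc r * (suc r ! * suc r !)                       ∎
    where
    step : ∀ r p q → suc (suc (r + r)) * (suc (suc (r + r)) * (p * (q * q))) ≡ 4 * p * (suc r * q * (suc r * q))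
    step = solve-∀

geometric : ∀ R T (a : ℕ → ℕ) → (∀ r → a r * 4 ^ r ≤ T) → 3 * sum {R} (a ∘ toℕ) ≤ 4 * T
geometric zero    T a h = z≤n
geometric (suc R) T a h = begin
  3 * (a 0 + sum {R} (a ∘ suc ∘ toℕ))      ≡⟨ *-distribˡ-+ 3 (a 0) _ ⟩
  3 * a 0 + 3 * sum {R} (a ∘ suc ∘ toℕ)    ≤⟨ +-mono-≤ (*-monoʳ-≤ 3 (≤-trans (≤-reflexive (sym (*-identityʳ (a 0)))) (h 0))) tail ⟩
  3 * T + T                                ≡⟨ +-comm (3 * T) T ⟩
  4 * T                                    ∎
  where
  open ≤-Reasoning
  swap34 : ∀ x → 4 * (3 * x) ≡ 3 * (4 * x)
  swap34 = solve-∀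
  shift : ∀ a p → 4 * a * p ≡ a * (4 * p)
  shift = solve-∀
  tail : 3 * sum {R} (a ∘ suc ∘ toℕ) ≤ T
  tail = *-cancelˡ-≤ 4 (≤-trans (≤-reflexive (trans (swap34 (sum {R} (a ∘ suc ∘ toℕ))) (cong (3 *_) (sym (sum-*ˡ {R} 4 (a ∘ suc ∘ toℕ))))))
    (geometric R T (λ r → 4 * a (suc r)) (λ r → ≤-trans (≤-reflexive (shift (a (suc r)) (4 ^ r))) (h (suc r)))))

-- The hypothesis bounds the r-subsets together by T / 4^r.
subset-union-bound : ∀ m T → 1 ≤ m → (c : Subset m → ℕ) → (∀ Y → ∣ Y ∣ ≡ 0 → c Y ≡ 0) →
                     (∀ Y → c Y * (4 * m) ^ ∣ Y ∣ ≤ ∣ Y ∣ ! * T) → 3 * ∑ (subsets m) c ≤ T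
subset-union-bound m T 1≤m c c∅ c≤ = begin
  3 * ∑ (subsets m) c                                      ≤⟨ *-monoʳ-≤ 3 (∑-mono (subsets m) c≤q) ⟩
  3 * ∑ (subsets m) (λ Y → q ∣ Y ∣)                        ≤⟨ *-monoʳ-≤ 3 (∑-subsets m q) ⟩
  3 * ((m C 0) * 0 + sum {m} (λ r → (m C suc (toℕ r)) * q (suc (toℕ r)))) ≡⟨ cong (3 *_) (cong (_+ sum {m} (λ r → (m C suc (toℕ r)) * q (suc (toℕ r)))) (*-zeroʳ (m C 0))) ⟩
  -- Sizes start at 1, so the series is T/4 + T/16 + ..., with sum T/3. The additional factor 4 in
  -- the terms accounts for this shift.
  3 * sum {m} (λ r → (m C suc (toℕ r)) * q (suc (toℕ r))) ≤⟨ *-cancelˡ-≤ 4 (≤-trans (≤-reflexive (swap34 m (λ r → (m C suc r) * q (suc r)))) (geometric m T (λ r → 4 * ((m C suc r) * q (suc r))) term)) ⟩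
  T                                                        ∎
  where
  open ≤-Reasoning
  nz : ∀ r → NonZero ((4 * m) ^ r)
  nz r = m^n≢0 (4 * m) r {{>-nonZero (≤-trans 1≤m (m≤n*m m 4))}}
  -- The rounded bound depends on the size alone, as grouping the subsets by size requires. The
  -- value at 0 comes from `c∅`.
  q : ℕ → ℕ
  q zero    = 0
  q (suc r) = _/_ ((suc r) ! * T) ((4 * m) ^ suc r) {{nz (suc r)}}
  c≤q : ∀ Y → c Y ≤ q ∣ Y ∣
  c≤q Y with ∣ Y ∣ | c∅ Y | c≤ Y
  ... | zero  | e | _  = ≤-reflexive (e refl)
  ... | suc r | _ | le = ≤-trans (≤-reflexive (sym (m*n/n≡m (c Y) _ {{nz (suc r)}}))) (/-monoˡ-≤ _ {{nz (suc r)}} le)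
  term : ∀ r → 4 * ((m C suc r) * q (suc r)) * 4 ^ r ≤ T
  term r = *-cancelˡ-≤ (m ^ suc r) {{m^n≢0 m (suc r) {{>-nonZero 1≤m}}}} (begin
    m ^ suc r * (4 * ((m C suc r) * q (suc r)) * 4 ^ r)  ≡⟨ shuffle (m ^ suc r) (m C suc r) (q (suc r)) (4 ^ r) ⟩
    (m C suc r) * (q (suc r) * (4 ^ suc r * m ^ suc r))  ≡⟨ cong (λ e → (m C suc r) * (q (suc r) * e)) (sym (^-distribʳ-* (suc r) 4 m)) ⟩
    (m C suc r) * (q (suc r) * (4 * m) ^ suc r)          ≤⟨ *-monoʳ-≤ (m C suc r) (m/n*n≤m ((suc r) ! * T) _ {{nz (suc r)}}) ⟩
    (m C suc r) * ((suc r) ! * T)                        ≡⟨ *-assoc (m C suc r) _ T ⟨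
    (m C suc r) * (suc r) ! * T                          ≤⟨ *-monoˡ-≤ T (nCk*k!≤n^k m (suc r)) ⟩
    m ^ suc r * T                                        ∎)
    where
    shuffle : ∀ a b c d → a * (4 * (b * c) * d) ≡ b * (c * (4 * d * a))
    shuffle = solve-∀
  swap34 : ∀ R (a : ℕ → ℕ) → 4 * (3 * sum {R} (a ∘ toℕ)) ≡ 3 * sum {R} (λ r → 4 * a (toℕ r))
  swap34 R a = trans (swap (sum {R} (a ∘ toℕ))) (cong (3 *_) (sym (sum-*ˡ {R} 4 (a ∘ toℕ))))
    where
    swap : ∀ x → 4 * (3 * x) ≡ 3 * (4 * x)
    swap = solve-∀

-- Existence of admissible rows

record Admissible (L s m n k d A g₀ : ℕ) (G : Vec (Row L s) m) : Set where
  field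
    small : ∀ R → ∣ R ∣ ≤ A → d * ∣ R ∣ ≤ new R G
    -- The surplus `d * n` in the conclusion pays for the at most n members of S that are dropped
    -- when a set of active elements is cut down to its suspects `Y`.
    large : ∀ (D : Vec (Row L s) n) Y → g₀ ≤ ∣ Y ∣ →
            All (λ r → k ≤ hits (toList D) r) (selected Y G) → d * (∣ Y ∣ + n) ≤ new Y G

module _ (L s m n k d g₀ : ℕ) (L≡ : L ≡ d + suc k) (1≤n : 1 ≤ n) (n≤s : n ≤ s) (1≤m : 1 ≤ m)
         (n≤g₀ : n ≤ g₀) (dn≤g₀ : d * n ≤ g₀)
         (root : 32 * 3 ^ L * m * (g₀ + n) ^ k ≤ s ^ suc k) (size : s ^ (2 * (L * n)) ≤ 2 ^ g₀) where

  private
    N = g₀ + n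
    T = (s ^ L) ^ m
    configurations = vectors (rows L s) m
    E = 3 ^ L * N ^ k

    1≤s : 1 ≤ s
    1≤s = ≤-trans 1≤n n≤s

    1≤E : 1 ≤ E
    1≤E = *-mono-≤ (m^n>0 3 L) (m^n>0 N {{>-nonZero (≤-trans 1≤n (m≤n+m n g₀))}} k)

    -- Both families of bad events end here. The 32 of `root` is 4 from `4 * m` in the union bound
    -- over subsets, times the 8 of `8 ^ r`: a factor 4 replaces powers by factorials and a factor 2
    -- is left for the choice of `D`.
    conclude : ∀ X r → X * s ^ (suc k * r) ≤ E ^ r * 8 ^ r * r ! * T → X * (4 * m) ^ r ≤ r ! * T
    conclude X r le = *-cancelˡ-≤ ((E * 8) ^ r) {{m^n≢0 (E * 8) r {{>-nonZero (*-mono-≤ 1≤E (s≤s (z≤n {7})))}}}} (begin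
      (E * 8) ^ r * (X * (4 * m) ^ r)   ≡⟨ swap ((E * 8) ^ r) X ((4 * m) ^ r) ⟩
      X * ((E * 8) ^ r * (4 * m) ^ r)   ≡⟨ cong (X *_) (sym (^-distribʳ-* r (E * 8) (4 * m))) ⟩
      X * (E * 8 * (4 * m)) ^ r         ≤⟨ *-monoʳ-≤ X (^-monoˡ-≤ r (≤-trans (≤-reflexive (regroup (3 ^ L) (N ^ k) m)) root)) ⟩
      X * (s ^ suc k) ^ r               ≡⟨ cong (X *_) (^-*-assoc s (suc k) r) ⟩
      X * s ^ (suc k * r)               ≤⟨ le ⟩
      E ^ r * 8 ^ r * r ! * T           ≡⟨ cong (λ e → e * r ! * T) (sym (^-distribʳ-* r E 8)) ⟩
      (E * 8) ^ r * r ! * T             ≡⟨ *-assoc ((E * 8) ^ r) (r !) T ⟩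
      (E * 8) ^ r * (r ! * T)           ∎)
      where
      open ≤-Reasoning
      swap : ∀ a b c → a * (b * c) ≡ b * (a * c)
      swap = solve-∀
      regroup : ∀ a b m → a * b * 8 * (4 * m) ≡ 32 * a * m * b
      regroup = solve-∀

    inSmall? : (Y : Subset m) → Dec (1 ≤ ∣ Y ∣ × ∣ Y ∣ ≤ N)
    inSmall? Y = (1 ≤? ∣ Y ∣) ×-dec (∣ Y ∣ ≤? N)

    badSmall : Subset m → Vec (Row L s) m → ℕ
    badSmall Y G = [ does (inSmall? Y) ] * [ does (crowded? 0 (d * ∣ Y ∣) [] Y G) ]

    badLarge : Subset m → Vec (Row L s) m → ℕ
    badLarge Y G = [ does (g₀ ≤? ∣ Y ∣) ] *
      ∑ (vectors (rows L s) n) (λ D → [ does (crowded? k (d * (∣ Y ∣ + n)) (toList D) Y G) ])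

    small-bound : ∀ Y → ∑ configurations (badSmall Y) * (4 * m) ^ ∣ Y ∣ ≤ ∣ Y ∣ ! * T
    small-bound Y = begin
      ∑ configurations (badSmall Y) * (4 * m) ^ r     ≡⟨ cong (_* (4 * m) ^ r) (∑-*ˡ configurations [ does (inSmall? Y) ] (λ G → [ does (crowded? {L} {s} 0 (d * ∣ Y ∣) [] Y G) ])) ⟩
      [ does (inSmall? Y) ] * X * (4 * m) ^ r         ≡⟨ *-assoc [ does (inSmall? Y) ] X _ ⟩
      [ does (inSmall? Y) ] * (X * (4 * m) ^ r)       ≤⟨ indicator-≤ (inSmall? Y) (λ (1≤r , r≤N) → conclude X r (begin
        -- With `D` empty, all k + 1 collisions per element are repeats inside `Y`; the bound on the
        -- number of rows of `D` is then set to 1.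
        X * s ^ (suc k * r)                              ≤⟨ crowdedCount-bound {L} {s} 0 (suc k * r) (d * r) Y 1 [] ≤-refl 1≤s 1≤r z≤n count ⟩
        3 ^ (L * r) * 1 * (r ^ (r + k * r)) * T          ≡⟨ cong (_* T) (cong₂ _*_ (trans (*-identityʳ (3 ^ (L * r))) (sym (^-*-assoc 3 L r))) (^-distribˡ-+-* r r (k * r))) ⟩
        (3 ^ L) ^ r * (r ^ r * r ^ (k * r)) * T          ≤⟨ *-monoˡ-≤ T (*-monoʳ-≤ ((3 ^ L) ^ r) (*-mono-≤ (≤-trans (r^r≤4^r*r! r) (*-monoˡ-≤ (r !) (^-monoˡ-≤ r (m≤m+n 4 4)))) (^-monoˡ-≤ (k * r) r≤N))) ⟩
        (3 ^ L) ^ r * (8 ^ r * r ! * N ^ (k * r)) * T    ≡⟨ cong (λ e → (3 ^ L) ^ r * (8 ^ r * r ! * e) * T) (sym (^-*-assoc N k r)) ⟩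
        (3 ^ L) ^ r * (8 ^ r * r ! * (N ^ k) ^ r) * T    ≡⟨ regroup ((3 ^ L) ^ r) (8 ^ r) (r !) ((N ^ k) ^ r) T ⟩
        (3 ^ L) ^ r * (N ^ k) ^ r * 8 ^ r * r ! * T      ≡⟨ cong (λ e → e * 8 ^ r * r ! * T) (sym (^-distribʳ-* r (3 ^ L) (N ^ k))) ⟩
        E ^ r * 8 ^ r * r ! * T                          ∎)) ⟩
      r ! * T                                         ∎
      where
      open ≤-Reasoning
      r = ∣ Y ∣
      X = crowdedCount {L} {s} 0 (d * ∣ Y ∣) [] Y
      regroup : ∀ a b c e t → a * (b * c * e) * t ≡ a * e * b * c * t
      regroup = solve-∀
      count : 0 * r + suc k * r + d * r ≡ L * r
      count = trans (trans (sym (*-distribʳ-+ r (suc k) d)) (cong (_* r) (+-comm (suc k) d))) (cong (_* r) (sym L≡))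

    large-bound : ∀ Y → ∑ configurations (badLarge Y) * (4 * m) ^ ∣ Y ∣ ≤ ∣ Y ∣ ! * T
    large-bound Y = begin
      ∑ configurations (badLarge Y) * (4 * m) ^ g     ≡⟨ cong (_* (4 * m) ^ g) (trans (∑-*ˡ configurations [ does (g₀ ≤? g) ] (λ G → ∑ (vectors (rows L s) n) (crowds G))) (cong ([ does (g₀ ≤? g) ] *_) (∑-swap configurations (vectors (rows L s) n) crowds))) ⟩
      [ does (g₀ ≤? g) ] * X * (4 * m) ^ g            ≡⟨ *-assoc [ does (g₀ ≤? g) ] X _ ⟩
      [ does (g₀ ≤? g) ] * (X * (4 * m) ^ g)          ≤⟨ indicator-≤ (g₀ ≤? g) (λ g₀≤g → conclude X g (begin
        X * s ^ (suc k * g)                              ≡⟨ ∑-*ʳ (vectors (rows L s) n) (s ^ (suc k * g)) (λ D → crowdedCount {L} {s} k f (toList D) Y) ⟨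
        ∑ (vectors (rows L s) n) (λ D → crowdedCount {L} {s} k f (toList D) Y * s ^ (suc k * g))
                                                         ≤⟨ ∑-mono (vectors (rows L s) n) (single g₀≤g) ⟩
        ∑ (vectors (rows L s) n) (λ _ → E ^ g * (4 ^ g * g !) * s ^ (d * n) * T)
                                                         ≡⟨ trans (∑-const (vectors (rows L s) n) _) (cong (_* (E ^ g * (4 ^ g * g !) * s ^ (d * n) * T)) (trans (length-vectors (rows L s) n) (cong (_^ n) (length-rows L s)))) ⟩
        (s ^ L) ^ n * (E ^ g * (4 ^ g * g !) * s ^ (d * n) * T)
                                                         ≡⟨ regroup ((s ^ L) ^ n) (E ^ g) (4 ^ g) (g !) (s ^ (d * n)) T ⟩
        E ^ g * (4 ^ g * ((s ^ L) ^ n * s ^ (d * n))) * g ! * T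
                                                         ≤⟨ *-monoˡ-≤ T (*-monoˡ-≤ (g !) (*-monoʳ-≤ (E ^ g) (*-monoʳ-≤ (4 ^ g) (encodings g₀≤g)))) ⟩
        E ^ g * (4 ^ g * 2 ^ g) * g ! * T                ≡⟨ cong (λ e → E ^ g * e * g ! * T) (sym (^-distribʳ-* g 4 2)) ⟩
        E ^ g * 8 ^ g * g ! * T                          ∎)) ⟩
      g ! * T                                         ∎
      where
      open ≤-Reasoning
      g = ∣ Y ∣
      f = d * (g + n)
      crowds : Vec (Row L s) m → Vec (Row L s) n → ℕ
      crowds G D = [ does (crowded? {L} {s} k f (toList D) Y G) ]
      X = ∑ (vectors (rows L s) n) (λ D → crowdedCount {L} {s} k f (toList D) Y)
      regroup : ∀ a b c e p t → a * (b * (c * e) * p * t) ≡ b * (c * (a * p)) * e * t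
      regroup = solve-∀
      -- The first factor counts the choices of `D`; the second is the price of the surplus `d * n`
      -- in the required number of new cells.
      encodings : g₀ ≤ g → (s ^ L) ^ n * s ^ (d * n) ≤ 2 ^ g
      encodings g₀≤g = begin
        (s ^ L) ^ n * s ^ (d * n)       ≡⟨ cong (_* s ^ (d * n)) (^-*-assoc s L n) ⟩
        s ^ (L * n) * s ^ (d * n)       ≡⟨ ^-distribˡ-+-* s (L * n) (d * n) ⟨
        s ^ (L * n + d * n)             ≤⟨ ^-monoʳ-≤ s {{>-nonZero 1≤s}} (+-monoʳ-≤ (L * n) (≤-trans (*-monoˡ-≤ n (≤-trans (m≤m+n d (suc k)) (≤-reflexive (sym L≡)))) (≤-reflexive (sym (+-identityʳ (L * n)))))) ⟩
        s ^ (2 * (L * n))               ≤⟨ size ⟩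
        2 ^ g₀                          ≤⟨ ^-monoʳ-≤ 2 g₀≤g ⟩
        2 ^ g                           ∎
      single : g₀ ≤ g → ∀ D → crowdedCount {L} {s} k f (toList D) Y * s ^ (suc k * g) ≤ E ^ g * (4 ^ g * g !) * s ^ (d * n) * T
      single g₀≤g D = begin
        cnt * s ^ (suc k * g)                              ≡⟨ cong (λ e → cnt * s ^ e) exponent ⟩
        cnt * s ^ (k * g + j + d * n)                      ≡⟨ cong (cnt *_) (^-distribˡ-+-* s (k * g + j) (d * n)) ⟩
        cnt * (s ^ (k * g + j) * s ^ (d * n))              ≡⟨ *-assoc cnt _ _ ⟨
        cnt * s ^ (k * g + j) * s ^ (d * n)                ≤⟨ *-monoˡ-≤ (s ^ (d * n)) (crowdedCount-bound {L} {s} k j f Y n (toList D) 1≤n n≤s (≤-trans n≤g₀ g₀≤g) (≤-reflexive (length-toList D)) count) ⟩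
        3 ^ (L * g) * n ^ (k * g) * g ^ j * T * s ^ (d * n) ≤⟨ *-monoˡ-≤ (s ^ (d * n)) (*-monoˡ-≤ T (*-mono-≤ (*-monoʳ-≤ (3 ^ (L * g)) (^-monoˡ-≤ (k * g) (m≤n+m n g₀))) g^j≤)) ⟩
        3 ^ (L * g) * N ^ (k * g) * (4 ^ g * g !) * T * s ^ (d * n) ≡⟨ swapʳ (3 ^ (L * g) * N ^ (k * g) * (4 ^ g * g !)) T (s ^ (d * n)) ⟩
        3 ^ (L * g) * N ^ (k * g) * (4 ^ g * g !) * s ^ (d * n) * T ≡⟨ cong (λ e → e * (4 ^ g * g !) * s ^ (d * n) * T) (trans (cong₂ _*_ (sym (^-*-assoc 3 L g)) (sym (^-*-assoc N k g))) (sym (^-distribʳ-* g (3 ^ L) (N ^ k)))) ⟩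
        E ^ g * (4 ^ g * g !) * s ^ (d * n) * T            ∎
        where
        cnt = crowdedCount {L} {s} k f (toList D) Y
        -- Besides its k hits every element has one repeat, except that the surplus inside `f` takes
        -- `d * n` of these repeats away.
        j = g ∸ d * n
        j+dn : j + d * n ≡ g
        j+dn = m∸n+n≡m (≤-trans dn≤g₀ g₀≤g)
        swapʳ : ∀ a b c → a * b * c ≡ a * c * b
        swapʳ = solve-∀
        exponent : suc k * g ≡ k * g + j + d * n
        exponent = trans (+-comm g (k * g)) (trans (cong (k * g +_) (sym j+dn)) (sym (+-assoc (k * g) j (d * n))))
        count : k * g + j + f ≡ L * g
        count = trans (trans (rearrange (k * g) j (d * n) (d * g) (*-distribˡ-+ d g n)) (cong (λ e → d * g + (e + k * g)) j+dn))
                  (trans (sym (*-distribʳ-+ g d (suc k))) (cong (_* g) (sym L≡)))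
          where
          rearrange : ∀ a b c e {x} → x ≡ e + c → a + b + x ≡ e + ((b + c) + a)
          rearrange a b c e refl = lemma a b c e
            where
            lemma : ∀ a b c e → a + b + (e + c) ≡ e + ((b + c) + a)
            lemma = solve-∀
        g^j≤ : g ^ j ≤ 4 ^ g * g !
        g^j≤ = ≤-trans (^-monoʳ-≤ g {{>-nonZero (≤-trans 1≤n (≤-trans n≤g₀ g₀≤g))}} (m∸n≤m g (d * n))) (r^r≤4^r*r! g)

    bad : Vec (Row L s) m → ℕ
    bad G = ∑ (subsets m) (λ Y → badSmall Y G) + ∑ (subsets m) (λ Y → badLarge Y G)

    ∑-bad : 3 * ∑ configurations bad ≤ 2 * T
    ∑-bad = begin
      3 * ∑ configurations bad
        ≡⟨ cong (3 *_) (trans (∑-+ configurations (λ G → ∑ (subsets m) (λ Y → badSmall Y G)) (λ G → ∑ (subsets m) (λ Y → badLarge Y G))) (cong₂ _+_ (∑-swap configurations (subsets m) (λ G Y → badSmall Y G)) (∑-swap configurations (subsets m) (λ G Y → badLarge Y G)))) ⟩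
      3 * (∑ (subsets m) (λ Y → ∑ configurations (badSmall Y)) + ∑ (subsets m) (λ Y → ∑ configurations (badLarge Y)))
        ≡⟨ *-distribˡ-+ 3 (∑ (subsets m) (λ Y → ∑ configurations (badSmall Y))) _ ⟩
      3 * ∑ (subsets m) (λ Y → ∑ configurations (badSmall Y)) + 3 * ∑ (subsets m) (λ Y → ∑ configurations (badLarge Y))
        ≤⟨ +-mono-≤ (subset-union-bound m T 1≤m (λ Y → ∑ configurations (badSmall Y)) small-∅ small-bound) (subset-union-bound m T 1≤m (λ Y → ∑ configurations (badLarge Y)) large-∅ large-bound) ⟩
      T + T
        ≡⟨ cong (T +_) (sym (+-identityʳ T)) ⟩
      2 * T ∎
      where
      open ≤-Reasoning
      no-indicator : ∀ {P : Set} (p? : Dec P) → ¬ P → [ does p? ] ≡ 0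
      no-indicator (yes p) ¬p = contradiction p ¬p
      no-indicator (no _)  ¬p = refl
      small-∅ : ∀ Y → ∣ Y ∣ ≡ 0 → ∑ configurations (badSmall Y) ≡ 0
      small-∅ Y e = trans (∑-*ˡ configurations [ does (inSmall? Y) ] (λ G → [ does (crowded? {L} {s} 0 (d * ∣ Y ∣) [] Y G) ])) (cong (_* crowdedCount {L} {s} 0 (d * ∣ Y ∣) [] Y) (no-indicator (inSmall? Y) (λ (1≤r , _) → n≮0 (subst (1 ≤_) e 1≤r))))
      large-∅ : ∀ Y → ∣ Y ∣ ≡ 0 → ∑ configurations (badLarge Y) ≡ 0
      large-∅ Y e = trans (∑-*ˡ configurations [ does (g₀ ≤? ∣ Y ∣) ] (λ G → ∑ (vectors (rows L s) n) (λ D → [ does (crowded? k (d * (∣ Y ∣ + n)) (toList D) Y G) ])))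
        (cong (_* ∑ configurations (λ G → ∑ (vectors (rows L s) n) (λ D → [ does (crowded? k (d * (∣ Y ∣ + n)) (toList D) Y G) ])))
          (no-indicator (g₀ ≤? ∣ Y ∣) (λ g₀≤ → n≮0 (subst (1 ≤_) e (≤-trans 1≤n (≤-trans n≤g₀ g₀≤))))))

    length-configurations : length configurations ≡ T
    length-configurations = trans (length-vectors (rows L s) m) (cong (_^ m) (length-rows L s))

    some-good : ∃ λ G → bad G ≡ 0
    some-good = ∑-zero-term configurations bad (≰⇒> λ T≤ → <⇒≱ 2T<3T (≤-trans (*-monoʳ-≤ 3 (subst (_≤ ∑ configurations bad) length-configurations T≤)) ∑-bad))
      where
      2T<3T : 2 * T < 3 * T
      2T<3T = *-monoˡ-< T {{m^n≢0 (s ^ L) m {{m^n≢0 s L {{>-nonZero 1≤s}}}}}} {2} {3} ≤-refl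

    indicator-zero : ∀ {P : Set} (p? : Dec P) → [ does p? ] ≡ 0 → ¬ P
    indicator-zero (no ¬p) _ = ¬p

    ∑-zero : ∀ {xs : List A} {f : A → ℕ} → ∑ xs f ≡ 0 → ∀ {x} → x ∈ˡ xs → f x ≡ 0
    ∑-zero {f = f} eq x∈ = n≤0⇒n≡0 (subst (f _ ≤_) eq (term≤∑ f x∈))

    given : ∀ {P : Set} (p? : Dec P) {x} → P → [ does p? ] * x ≡ 0 → x ≡ 0
    given (yes _) {x} _ eq = trans (sym (+-identityʳ x)) eq
    given (no ¬p) p _  = contradiction p ¬p

    good⇒admissible : ∀ G → bad G ≡ 0 → Admissible L s m n k d N g₀ G
    good⇒admissible G badG = record { small = small ; large = large }
      where
      small : ∀ R → ∣ R ∣ ≤ N → d * ∣ R ∣ ≤ new R G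
      small R R≤N with 1 ≤? ∣ R ∣
      ... | no  R<1 = ≤-trans (≤-reflexive (trans (cong (d *_) (n<1⇒n≡0 (≰⇒> R<1))) (*-zeroʳ d))) z≤n
      ... | yes 1≤R = <⇒≤ (≰⇒> λ new≤ → indicator-zero (crowded? {L} {s} 0 (d * ∣ R ∣) [] R G)
            (given (inSmall? R) (1≤R , R≤N) (∑-zero {f = λ Y → badSmall Y G} (m+n≡0⇒m≡0 (∑ (subsets m) (λ Y → badSmall Y G)) badG) (∈-subsets R)))
            (All.universal (λ _ → z≤n) _ , new≤))

      large : ∀ (D : Vec (Row L s) n) Y → g₀ ≤ ∣ Y ∣ →
              All (λ r → k ≤ hits (toList D) r) (selected Y G) → d * (∣ Y ∣ + n) ≤ new Y G
      large D Y g₀≤ hit = <⇒≤ (≰⇒> λ new≤ → indicator-zero (crowded? {L} {s} k (d * (∣ Y ∣ + n)) (toList D) Y G)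
        (∑-zero {f = λ D → [ does (crowded? {L} {s} k (d * (∣ Y ∣ + n)) (toList D) Y G) ]} (given (g₀ ≤? ∣ Y ∣) g₀≤ (∑-zero {f = λ Y → badLarge Y G} (m+n≡0⇒n≡0 (∑ (subsets m) (λ Y → badSmall Y G)) badG) (∈-subsets Y)))
                (∈-vectors (∈-vectors ∈-allFin) D))
        (hit , new≤))

  admissible-rows : ∃ (Admissible L s m n k d (g₀ + n) g₀)
  admissible-rows = proj₁ some-good , good⇒admissible (proj₁ some-good) (proj₂ some-good)

-- Subsets

restrict : ∀ {m} → (Fin m → Bool) → Subset m → Subset m
restrict z []      = []
restrict z (b ∷ R) = (b ∧ z zero) ∷ restrict (z ∘ suc) R

lookup-restrict : ∀ {m} (z : Fin m → Bool) R u → lookup (restrict z R) u ≡ lookup R u ∧ z u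
lookup-restrict z (b ∷ R) zero    = refl
lookup-restrict z (b ∷ R) (suc u) = lookup-restrict (z ∘ suc) R u

∣∷∣ : ∀ {m} b (R : Subset m) → ∣ b ∷ R ∣ ≡ [ b ] + ∣ R ∣
∣∷∣ false R = refl
∣∷∣ true  R = refl

weight-restrict : ∀ {m} (z : Fin m → Bool) d R → weight (λ u → [ z u ] * d) R ≡ d * ∣ restrict z R ∣
weight-restrict z d []      = sym (*-zeroʳ d)
weight-restrict z d (b ∷ R)
  rewrite ∣∷∣ (b ∧ z zero) (restrict (z ∘ suc) R) | weight-restrict (z ∘ suc) d R =
  trans (cong (_+ d * ∣ restrict (z ∘ suc) R ∣) (head≡ b (z zero))) (sym (*-distribˡ-+ d [ b ∧ z zero ] _))
  where
  head≡ : ∀ b c → [ b ] * ([ c ] * d) ≡ d * [ b ∧ c ]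
  head≡ false c     = sym (*-zeroʳ d)
  head≡ true  false = sym (*-zeroʳ d)
  head≡ true  true  = trans (+-identityʳ _) (trans (+-identityʳ d) (sym (*-identityʳ d)))

covers-restrict : ∀ {m s} (N : Incidence m s) z R x → [ covers N (restrict z R) x ] ≤ [ covers N R x ]
covers-restrict N z []      x = z≤n
covers-restrict N z (b ∷ R) x = shrink b (z zero) (N zero x) (covers-restrict (N ∘ suc) (z ∘ suc) R x)
  where
  shrink : ∀ b c n {p q} → [ p ] ≤ [ q ] → [ (b ∧ c) ∧ n ∨ p ] ≤ [ b ∧ n ∨ q ]
  shrink false c     n     le = le
  shrink true  c     true  {p} le = []≤1 (c ∧ true ∨ p)
  shrink true  false false le = le
  shrink true  true  false le = le

coverage-restrict : ∀ {m s} (N : Incidence m s) z R → coverage N (restrict z R) ≤ coverage N R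
coverage-restrict N z R = sum-mono (covers-restrict N z R)

∣∣≤restrict-not+ : ∀ {m} (R S : Subset m) → ∣ R ∣ ≤ ∣ restrict (not ∘ lookup S) R ∣ + ∣ S ∣
∣∣≤restrict-not+ []      []      = z≤n
∣∣≤restrict-not+ (b ∷ R) (c ∷ S)
  rewrite ∣∷∣ b R | ∣∷∣ c S | ∣∷∣ (b ∧ not c) (restrict (not ∘ lookup S) R) =
  ≤-trans (+-mono-≤ (head≤ b c) (∣∣≤restrict-not+ R S)) (≤-reflexive (shuffle [ b ∧ not c ] [ c ] _ _))
  where
  head≤ : ∀ b c → [ b ] ≤ [ b ∧ not c ] + [ c ]
  head≤ false c     = z≤n
  head≤ true  false = ≤-refl
  head≤ true  true  = ≤-refl
  shuffle : ∀ a b c d → a + b + (c + d) ≡ a + c + (b + d)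
  shuffle = solve-∀

selected-All : ∀ {P : A → Set} {m} (Y : Subset m) (G : Vec A m) →
               (∀ u → lookup Y u ≡ true → P (lookup G u)) → All P (selected Y G)
selected-All []          []      h = []
selected-All (false ∷ Y) (r ∷ G) h = selected-All Y G (h ∘ suc)
selected-All (true ∷ Y)  (r ∷ G) h = h zero refl ∷ selected-All Y G (h ∘ suc)

-- Exactly n rows are produced, so that the union bound runs over a single finite type. A filler row
-- can only create further suspects, and `large` holds for every `D`.
selectedPadded : ∀ {m} → A → Subset m → Vec A m → ∀ n → Vec A n
selectedPadded r₀ []          []      n       = replicate n r₀
selectedPadded r₀ (false ∷ S) (r ∷ G) n       = selectedPadded r₀ S G n
selectedPadded r₀ (true ∷ S)  (r ∷ G) zero    = []
selectedPadded r₀ (true ∷ S)  (r ∷ G) (suc n) = r ∷ selectedPadded r₀ S G n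

∈-selectedPadded : ∀ {m} (r₀ : A) (S : Subset m) (G : Vec A m) {n} → ∣ S ∣ ≤ n → ∀ u → lookup S u ≡ true →
                   lookup G u ∈ˡ toList (selectedPadded r₀ S G n)
∈-selectedPadded r₀ (true ∷ S)  (r ∷ G) (s≤s le) zero    _ = here refl
∈-selectedPadded r₀ (false ∷ S) (r ∷ G) le       (suc u) p = ∈-selectedPadded r₀ S G le u p
∈-selectedPadded r₀ (true ∷ S)  (r ∷ G) (s≤s le) (suc u) p = there (∈-selectedPadded r₀ S G le u p)

-- Incidence of elements and locations

δ≤1 : ∀ {n} (i j : Fin n) → δ i j ≤ 1
δ≤1 zero    zero    = ≤-refl
δ≤1 zero    (suc j) = z≤n
δ≤1 (suc i) zero    = z≤n
δ≤1 (suc i) (suc j) = δ≤1 i j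

owns≤1 : ∀ {a s} (own : Fin s → Maybe (Fin a)) u x → owns own u x ≤ 1
owns≤1 own u x with own x
... | nothing = z≤n
... | just v  = δ≤1 u v

owns-positive : ∀ {a s} (own : Fin s → Maybe (Fin a)) u x → 0 < owns own u x → own x ≡ just u
owns-positive own u x p with own x
... | just v = cong just (sym (δ-positive u v p))

module _ {L s : ℕ} where

  slotOf : Fin (L * s) → Fin L
  slotOf x = proj₁ (remQuot {L} s x)

  indexOf : Fin (L * s) → Fin s
  indexOf x = proj₂ (remQuot {L} s x)

  location : Row L s → Fin L → Fin (L * s)
  location r z = combine {L} {s} z (lookup r z)

  contains : Row L s → Fin (L * s) → Bool
  contains r x = does (lookup r (slotOf x) ≟ indexOf x)

  incidence : ∀ {m} → Vec (Row L s) m → Incidence m (L * s)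
  incidence G u = contains (lookup G u)

  contains-combine : ∀ r z c → contains r (combine {L} {s} z c) ≡ does (lookup r z ≟ c)
  contains-combine r z c = cong (λ y → does (lookup r (proj₁ y) ≟ proj₂ y)) (remQuot-combine {L} {s} z c)

  contains⇒≡ : ∀ r z c → contains r (combine {L} {s} z c) ≡ true → lookup r z ≡ c
  contains⇒≡ r z c eq with lookup r z ≟ c | contains-combine r z c
  ... | yes p | _ = p
  ... | no _  | e = contradiction (trans (sym eq) e) λ ()

  covers≤mult : ∀ {m} R (G : Vec (Row L s) m) z c → [ covers (incidence G) R (combine {L} {s} z c) ] ≤ mult (selected R G) z c
  covers≤mult []          []      z c = z≤n
  covers≤mult (false ∷ R) (r ∷ G) z c = covers≤mult R G z c
  covers≤mult (true ∷ R)  (r ∷ G) z c with contains r (combine {L} {s} z c) in eq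
  ... | false = ≤-trans (covers≤mult R G z c) (m≤n+m _ _)
  ... | true  with refl ← contains⇒≡ r z c eq = ≤-trans (≤-reflexive (sym (δ-refl (lookup r z)))) (m≤m+n _ _)

  new≤coverage : ∀ {m} R (G : Vec (Row L s) m) → new R G ≤ coverage (incidence G) R
  new≤coverage []          []      = z≤n
  new≤coverage (false ∷ R) (r ∷ G) = new≤coverage R G
  new≤coverage (true ∷ R)  (r ∷ G) = begin
    fresh (selected R G) r + new R G
      ≤⟨ +-monoʳ-≤ (fresh (selected R G) r) (new≤coverage R G) ⟩
    fresh (selected R G) r + sum (λ x → [ covered x ])
      ≡⟨ cong (fresh (selected R G) r +_) (sum-combine L {s} (λ x → [ covered x ])) ⟩
    fresh (selected R G) r + sum (λ z → sum (λ c → [ covered (combine {L} {s} z c) ]))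
      ≡⟨ ∑-distrib-+ {L} (λ z → isZero (mult (selected R G) z (lookup r z))) (λ z → sum (λ c → [ covered (combine {L} {s} z c) ])) ⟨
    sum (λ z → isZero (mult (selected R G) z (lookup r z)) + sum (λ c → [ covered (combine {L} {s} z c) ]))
      ≤⟨ sum-mono slot≤ ⟩
    sum (λ z → sum (λ c → [ contains r (combine {L} {s} z c) ∨ covered (combine {L} {s} z c) ]))
      ≡⟨ sum-combine L {s} (λ x → [ contains r x ∨ covered x ]) ⟨
    sum (λ x → [ contains r x ∨ covered x ]) ∎
    where
    open ≤-Reasoning
    covered : Fin (L * s) → Bool
    covered = covers (incidence G) R
    [∨] : ∀ a b → [ b ] ≤ [ a ∨ b ]
    [∨] false b = ≤-refl
    [∨] true  b = []≤1 b
    slot≤ : ∀ z → isZero (mult (selected R G) z (lookup r z)) + sum (λ c → [ covered (combine {L} {s} z c) ]) ≤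
                  sum (λ c → [ contains r (combine {L} {s} z c) ∨ covered (combine {L} {s} z c) ])
    slot≤ z with mult (selected R G) z (lookup r z) | covers≤mult R G z (lookup r z)
    ... | suc _ | _  = sum-mono (λ c → [∨] (contains r (combine {L} {s} z c)) _)
    ... | zero  | le = sum-mono-< (λ c → [∨] (contains r (combine {L} {s} z c)) _) (lookup r z)
      (≤-trans (s≤s le) (≤-trans (≤-reflexive (cong [_] (sym hit))) ([a]≤[a∨b] (contains r (combine {L} {s} z (lookup r z))) _)))
      where
      hit : contains r (combine {L} {s} z (lookup r z)) ≡ true
      hit = trans (contains-combine r z (lookup r z)) (dec-true (lookup r z ≟ lookup r z) refl)
      [a]≤[a∨b] : ∀ a b → [ a ] ≤ [ a ∨ b ]
      [a]≤[a∨b] false b = z≤n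
      [a]≤[a∨b] true  b = ≤-refl

  mult-∈ : ∀ {rs : List (Row L s)} {r} z → r ∈ˡ rs → 0 < mult rs z (lookup r z)
  mult-∈ {r = r} z (here refl) = ≤-trans (≤-reflexive (sym (δ-refl (lookup r z)))) (m≤m+n _ _)
  mult-∈         z (there p)   = ≤-trans (mult-∈ z p) (m≤n+m _ _)

  lost : ∀ {m} → (Fin (L * s) → Maybe (Fin m)) → Vec (Row L s) m → Fin m → Fin L → ℕ
  lost own G u z = isZero (owns own u (location (lookup G u) z))

  -- In each slot `u` can own no cell but the one named by its row, so owned cells and lost slots
  -- together number at most `L`.
  lost-total : ∀ {m} (G : Vec (Row L s) m) (own : Fin (L * s) → Maybe (Fin m)) →
    (∀ x u → own x ≡ just u → incidence G u x ≡ true) →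
    ∀ d e u → L ≡ d + e → d ≤ sum (owns own u) → sum (lost own G u) ≤ e
  lost-total G own sound d e u L≡ d≤ = +-cancelˡ-≤ d _ _ (begin
    d + sum (lost own G u)
      ≤⟨ +-monoˡ-≤ _ d≤ ⟩
    sum (owns own u) + sum (lost own G u)
      ≡⟨ cong (_+ sum (lost own G u)) (sum-combine L {s} (owns own u)) ⟩
    sum (λ z → sum (λ c → owns own u (combine {L} {s} z c))) + sum (lost own G u)
      ≤⟨ +-monoˡ-≤ _ (sum-mono λ z → ≤-trans (sum-mono (only z)) (≤-reflexive (sum-*δ (here? z) (lookup (lookup G u) z)))) ⟩
    sum here? + sum (lost own G u)
      ≡⟨ ∑-distrib-+ here? (lost own G u) ⟨
    sum (λ z → here? z + lost own G u z)
      ≤⟨ sum-mono (λ z → x+isZero≤1 (here? z) (owns≤1 own u (location (lookup G u) z))) ⟩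
    sum {L} (λ _ → 1)
      ≡⟨ trans (sum-const L 1) (*-identityʳ L) ⟩
    L
      ≡⟨ L≡ ⟩
    d + e ∎)
    where
    open ≤-Reasoning
    here? : Fin L → ℕ
    here? z = owns own u (location (lookup G u) z)
    x+isZero≤1 : ∀ x → x ≤ 1 → x + isZero x ≤ 1
    x+isZero≤1 zero    _       = ≤-refl
    x+isZero≤1 (suc x) (s≤s p) = s≤s (≤-trans (≤-reflexive (+-identityʳ x)) p)
    only : ∀ z c → owns own u (combine {L} {s} z c) ≤ here? z * δ (lookup (lookup G u) z) c
    only z c with owns own u (combine {L} {s} z c) in eq
    ... | zero  = z≤n
    ... | suc _ with refl ← contains⇒≡ (lookup G u) z c
                      (sound (combine {L} {s} z c) u (owns-positive own u (combine {L} {s} z c) (subst (0 <_) (sym eq) (s≤s z≤n))))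
                = ≤-reflexive (trans (sym eq) (sym (trans (cong (here? z *_) (δ-refl (lookup (lookup G u) z))) (*-identityʳ (here? z)))))

-- Decision trees

-- Every bit is probed even after the count is reached; `pred 0 = 0` then keeps the answer at yes.
threshold : ∀ {s b} → (Fin b → Fin s) → ℕ → DTree s b
threshold {b = zero}  a zero    = leaf true
threshold {b = zero}  a (suc c) = leaf false
threshold {b = suc b} a c       = node (a zero) (threshold (a ∘ suc) c) (threshold (a ∘ suc) (pred c))

ones : ∀ {s b} → (Fin b → Fin s) → Vec Bool s → ℕ
ones a w = sum (λ i → [ lookup w (a i) ])

threshold-true : ∀ {s b} (a : Fin b → Fin s) c w → c ≤ ones a w → eval (threshold a c) w ≡ true
threshold-true {b = zero}  a zero    w _ = refl
threshold-true {b = suc b} a c       w le with lookup w (a zero)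
... | false = threshold-true (a ∘ suc) c w le
... | true  = threshold-true (a ∘ suc) (pred c) w (pred-mono-≤ le)

threshold-false : ∀ {s b} (a : Fin b → Fin s) c w → ones a w < c → eval (threshold a c) w ≡ false
threshold-false {b = zero}  a (suc c) w _ = refl
threshold-false {b = suc b} a c       w lt with lookup w (a zero)
... | false = threshold-false (a ∘ suc) c w lt
... | true  = threshold-false (a ∘ suc) (pred c) w (pred-mono-≤ lt)

eval-node : ∀ {s e} x (t₀ t₁ : DTree s e) w → eval (node x t₀ t₁) w ≡ eval (if lookup w x then t₁ else t₀) w
eval-node x t₀ t₁ w with lookup w x
... | false = refl
... | true  = refl

-- Routing a query around lost slots

root : Fin 7
root = zero

pointer : Bool → Fin 7
pointer false = suc zero
pointer true  = suc (suc zero)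

block : Bool → Bool → Fin 7
block false false = suc (suc (suc zero))
block false true  = suc (suc (suc (suc zero)))
block true  false = suc (suc (suc (suc (suc zero))))
block true  true  = suc (suc (suc (suc (suc (suc zero)))))

module Routing (k₁ : ℕ) (ℓ : Fin 7 → ℕ) where

  choosePointer : Bool → Bool
  choosePointer p = not (does (ℓ (block p false) ≤? k₁))

  side : Bool → ℕ
  side p = ℓ (pointer p) + (ℓ (block p false) + ℓ (block p true))

  chooseRoot : Bool
  chooseRoot = not (does (side false ≤? suc k₁))

  sides : sum ℓ ≡ ℓ root + (side false + side true)
  sides = lemma (ℓ zero) (ℓ (pointer false)) (ℓ (pointer true)) (ℓ (block false false)) (ℓ (block false true)) (ℓ (block true false)) _
    where
    lemma : ∀ r a₀ a₁ b₀ b₁ b₂ b₃ → r + (a₀ + (a₁ + (b₀ + (b₁ + (b₂ + (b₃ + 0)))))) ≡ r + ((a₀ + (b₀ + b₁)) + (a₁ + (b₂ + b₃)))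
    lemma = solve-∀

  module _ (total : sum ℓ ≤ suc (suc k₁)) where

    side≤sides : ∀ p → side p ≤ side false + side true
    side≤sides false = m≤m+n (side false) (side true)
    side≤sides true  = m≤n+m (side true) (side false)

    -- The root bit is under control only if its group has no loss. Otherwise that loss leaves at
    -- most `suc k₁` for both sides together, and any bit will do. `block-light` repeats this one
    -- level down.
    side-light : ∀ p → (ℓ root ≡ 0 → p ≡ chooseRoot) → side p ≤ suc k₁
    side-light p free = split (ℓ root) refl
      where
      open ≤-Reasoning
      chosen : side false + side true ≤ suc (suc k₁) → (le? : Dec (side false ≤ suc k₁)) →
               ∀ p → p ≡ not (does le?) → side p ≤ suc k₁
      chosen both (yes le) p refl = le
      -- One side exceeds `suc k₁` only by taking all `suc (suc k₁)` losses, so the other side has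
      -- none.
      chosen both (no ¬le) p refl = ≤-trans (+-cancelˡ-≤ (suc (suc k₁)) (side true) 0 (begin
        suc (suc k₁) + side true ≤⟨ +-monoˡ-≤ (side true) (≰⇒> ¬le) ⟩
        side false + side true   ≤⟨ both ⟩
        suc (suc k₁)             ≡⟨ +-identityʳ _ ⟨
        suc (suc k₁) + 0         ∎)) z≤n
      split : ∀ x → ℓ root ≡ x → side p ≤ suc k₁
      split x e with ≤-trans (≤-reflexive (trans (cong (_+ (side false + side true)) (sym e)) (sym sides))) total
      split (suc x) e | le = ≤-trans (side≤sides p) (≤-trans (m≤n+m _ x) (pred-mono-≤ le))
      split zero    e | le = chosen le (side false ≤? suc k₁) p (free e)

    block-light : ∀ p q → (ℓ root ≡ 0 → p ≡ chooseRoot) → (ℓ (pointer p) ≡ 0 → q ≡ choosePointer p) →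
                  ℓ (block p q) ≤ k₁
    block-light p q freeᵣ freeₚ with ℓ (pointer p) | side-light p freeᵣ
    ... | suc x | le = ≤-trans (block≤ q) (≤-trans (m≤n+m _ x) (pred-mono-≤ le))
      where
      block≤ : ∀ q → ℓ (block p q) ≤ ℓ (block p false) + ℓ (block p true)
      block≤ false = m≤m+n _ _
      block≤ true  = m≤n+m _ _
    ... | zero  | le = chosen (ℓ (block p false) ≤? k₁) q (freeₚ refl)
      where
      chosen : (le? : Dec (ℓ (block p false) ≤ k₁)) → ∀ q → q ≡ not (does le?) → ℓ (block p q) ≤ k₁
      chosen (yes le′) q refl = le′
      chosen (no ¬le)  q refl = ≤-trans (+-cancelˡ-≤ (suc k₁) (ℓ (block p true)) 0
        (≤-trans (+-monoˡ-≤ (ℓ (block p true)) (≰⇒> ¬le)) (≤-trans le (≤-reflexive (sym (+-identityʳ _)))))) z≤n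

-- The storing scheme and its correctness

module Construction (k₁ s m n d g₀ : ℕ) (1≤s : 1 ≤ s) where

  -- Here `b` is 2k - 1, so `k` ones form a majority of a block, and the depth `b + 2` is 2k + 1.
  b k L : ℕ
  b = suc (k₁ + k₁)
  k = suc k₁
  L = 7 * b

  module _ (L≡ : L ≡ d + suc k) (G : Vec (Row L s) m) (admissible : Admissible L s m n k d (g₀ + n) g₀ G) where

    open Admissible admissible

    cell : Fin m → Fin 7 → Fin b → Fin (L * s)
    cell u g i = location {L} {s} (lookup G u) (combine g i)

    groupOf : Fin (L * s) → Fin 7
    groupOf x = proj₁ (remQuot {7} b (slotOf {L} {s} x))

    groupOf-combine : ∀ g i c → groupOf (combine {L} {s} (combine {7} {b} g i) c) ≡ g
    groupOf-combine g i c = trans (cong (λ y → proj₁ (remQuot {7} b (proj₁ y))) (remQuot-combine {L} {s} (combine {7} {b} g i) c))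
                                  (cong proj₁ (remQuot-combine {7} {b} g i))

    blockTree : Fin m → Bool → Bool → DTree (L * s) b
    blockTree u p q = threshold (cell u (block p q)) k

    sideTree : Fin m → Bool → DTree (L * s) (suc b)
    sideTree u p = node (cell u (pointer p) zero) (blockTree u p false) (blockTree u p true)

    queryTree : Fin m → DTree (L * s) (suc (suc b))
    queryTree u = node (cell u root zero) (sideTree u false) (sideTree u true)

    module Memory (S : Subset m) (S≤n : ∣ S ∣ ≤ n) where

      D : Vec (Row L s) n
      D = selectedPadded (replicate L (fromℕ< 1≤s)) S G n

      -- Hits are counted over all seven groups: the pointers of a non-suspect hold arbitrary bits
      -- and may lead to any of the four blocks.
      near : Fin m → Bool
      near u = does (k ≤? hits (toList D) (lookup G u))

      active : Fin m → Bool
      active u = lookup S u ∨ near u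

      demand : Fin m → ℕ
      demand u = [ active u ] * d

      -- Small sets expand by `small`. A set of more than `g₀ + n` active elements has at least `g₀`
      -- suspects outside `S`, and these alone touch enough cells for the whole set.
      activeHall : HallCondition (incidence {L} {s} G) demand
      activeHall R = begin
        weight demand R             ≡⟨ weight-restrict active d R ⟩
        d * ∣ R′ ∣                  ≤⟨ expand ⟩
        coverage (incidence G) R′   ≤⟨ coverage-restrict (incidence G) active R ⟩
        coverage (incidence G) R    ∎
        where
        open ≤-Reasoning
        R′ = restrict active R
        Y = restrict (not ∘ lookup S) R′
        near-Y : ∀ u → lookup Y u ≡ true → k ≤ hits (toList D) (lookup G u)
        near-Y u eq = does⇒ (k ≤? hits (toList D) (lookup G u))
          (outside (lookup R u) (lookup S u) (near u) (trans (cong (_∧ not (lookup S u)) (sym (lookup-restrict active R u)))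
            (trans (sym (lookup-restrict (not ∘ lookup S) R′ u)) eq)))
          where
          does⇒ : ∀ {P : Set} (p? : Dec P) → does p? ≡ true → P
          does⇒ (yes p) _ = p
          outside : ∀ x y z → (x ∧ (y ∨ z)) ∧ not y ≡ true → z ≡ true
          outside true false true _ = refl
          outside true true  z    ()
        expand : d * ∣ R′ ∣ ≤ coverage (incidence G) R′
        expand with ∣ R′ ∣ ≤? g₀ + n
        ... | yes le = ≤-trans (small R′ le) (new≤coverage R′ G)
        ... | no ¬le = begin
          d * ∣ R′ ∣                 ≤⟨ *-monoʳ-≤ d R′≤ ⟩
          d * (∣ Y ∣ + n)            ≤⟨ large D Y (+-cancelʳ-≤ n g₀ ∣ Y ∣ (≤-trans (<⇒≤ (≰⇒> ¬le)) R′≤)) (selected-All Y G near-Y) ⟩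
          new Y G                    ≤⟨ new≤coverage Y G ⟩
          coverage (incidence G) Y   ≤⟨ coverage-restrict (incidence G) (not ∘ lookup S) R′ ⟩
          coverage (incidence G) R′  ∎
          where
          R′≤ : ∣ R′ ∣ ≤ ∣ Y ∣ + n
          R′≤ = ≤-trans (∣∣≤restrict-not+ R′ S) (+-monoʳ-≤ ∣ Y ∣ S≤n)

      module WithOwner (own : Fin (L * s) → Maybe (Fin m))
                       (sound : ∀ x u → own x ≡ just u → incidence {L} {s} G u x ≡ true)
                       (enough : ∀ u → demand u ≤ sum (owns own u)) where

        groupLost : Fin m → Fin 7 → ℕ
        groupLost u g = sum (λ i → lost {L} {s} own G u (combine {7} {b} g i))

        value : Fin m → Fin 7 → Bool
        value u zero             = Routing.chooseRoot k₁ (groupLost u)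
        value u (suc zero)       = Routing.choosePointer k₁ (groupLost u) false
        value u (suc (suc zero)) = Routing.choosePointer k₁ (groupLost u) true
        value u _                = lookup S u

        value-pointer : ∀ u p → value u (pointer p) ≡ Routing.choosePointer k₁ (groupLost u) p
        value-pointer u false = refl
        value-pointer u true  = refl

        value-block : ∀ u p q → value u (block p q) ≡ lookup S u
        value-block u false false = refl
        value-block u false true  = refl
        value-block u true  false = refl
        value-block u true  true  = refl

        -- The default `false` matters: a 1 in a block cell certifies an owner in `S`.
        bit : Fin (L * s) → Bool
        bit x = maybe (λ u → value u (groupOf x)) false (own x)

        memory : Vec Bool (L * s)
        memory = Vec.tabulate bit

        owned-bit : ∀ u g i → lost {L} {s} own G u (combine {7} {b} g i) ≡ 0 → lookup memory (cell u g i) ≡ value u g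
        owned-bit u g i eq = trans (lookup∘tabulate bit (cell u g i)) (helper (own (cell u g i)) (owns-positive own u (cell u g i) (positive′ _ eq)))
          where
          positive′ : ∀ x → isZero x ≡ 0 → 0 < x
          positive′ (suc x) _ = s≤s z≤n
          helper : ∀ o → o ≡ just u → maybe (λ v → value v (groupOf (cell u g i))) false o ≡ value u g
          helper _ refl = cong (value u) (groupOf-combine g i (lookup (lookup G u) (combine g i)))

        active-lost : ∀ u → active u ≡ true → sum (groupLost u) ≤ suc k
        active-lost u eq = ≤-trans (≤-reflexive (sym (sum-combine 7 {b} (lost {L} {s} own G u))))
          (lost-total {L} {s} G own sound d (suc k) u L≡ (≤-trans (≤-reflexive (sym (trans (cong (λ a → [ a ] * d) eq) (+-identityʳ d)))) (enough u)))

        rootBit : Fin m → Bool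
        rootBit u = lookup memory (cell u root zero)

        pointerBit : Fin m → Bool → Bool
        pointerBit u p = lookup memory (cell u (pointer p) zero)

        eval-query : ∀ u → eval (queryTree u) memory ≡ eval (blockTree u (rootBit u) (pointerBit u (rootBit u))) memory
        eval-query u = trans (eval-node (cell u root zero) (sideTree u false) (sideTree u true) memory) (trans (pick (rootBit u))
          (trans (eval-node (cell u (pointer (rootBit u)) zero) (blockTree u (rootBit u) false) (blockTree u (rootBit u) true) memory) (pick′ (rootBit u) (pointerBit u (rootBit u)))))
          where
          pick : ∀ p → eval (if p then sideTree u true else sideTree u false) memory ≡ eval (sideTree u p) memory
          pick false = refl
          pick true  = refl
          pick′ : ∀ p q → eval (if q then blockTree u p true else blockTree u p false) memory ≡ eval (blockTree u p q) memory
          pick′ p false = refl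
          pick′ p true  = refl

        light : ∀ u → active u ≡ true → groupLost u (block (rootBit u) (pointerBit u (rootBit u))) ≤ k₁
        light u eq = Routing.block-light k₁ (groupLost u) (active-lost u eq) (rootBit u) _
          (λ z → owned-bit u root zero (first-zero root z))
          (λ z → trans (owned-bit u (pointer (rootBit u)) zero (first-zero (pointer (rootBit u)) z)) (value-pointer u (rootBit u)))
          where
          -- Only the first slot of a pointer group is probed, but a loss in an idle slot is charged
          -- to the group too. Routing trusts the pointer only when the whole group is free, and
          -- otherwise uses the charged loss.
          first-zero : ∀ g → groupLost u g ≡ 0 → lost {L} {s} own G u (combine {7} {b} g zero) ≡ 0
          first-zero g z = n≤0⇒n≡0 (≤-trans (term≤sum (λ i → lost {L} {s} own G u (combine {7} {b} g i)) zero) (≤-reflexive z))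

        lost-or-set : ∀ u p q i → lookup S u ≡ true →
          1 ≤ [ lookup memory (cell u (block p q) i) ] + lost {L} {s} own G u (combine {7} {b} (block p q) i)
        lost-or-set u p q i u∈S with lost {L} {s} own G u (combine {7} {b} (block p q) i) in eq
        ... | suc _ = ≤-trans (s≤s z≤n) (m≤n+m _ _)
        ... | zero  rewrite owned-bit u (block p q) i eq | value-block u p q | u∈S = ≤-refl

        set⇒lost : ∀ u p q i → lookup S u ≡ false →
          [ lookup memory (cell u (block p q) i) ] ≤ lost {L} {s} own G u (combine {7} {b} (block p q) i)
        set⇒lost u p q i u∉S with lost {L} {s} own G u (combine {7} {b} (block p q) i) in eq
        ... | suc _ = ≤-trans ([]≤1 (lookup memory (cell u (block p q) i))) (s≤s z≤n)
        ... | zero  rewrite owned-bit u (block p q) i eq | value-block u p q | u∉S = z≤n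

        -- A cell belongs to one slot only, so its owner, a member of `S`, collides with `u` in that
        -- very slot. This holds for every `u`, and it is what protects the non-suspects.
        set⇒hit : ∀ u p q i →
          [ lookup memory (cell u (block p q) i) ] ≤
            positive (mult (toList D) (combine {7} {b} (block p q) i) (lookup (lookup G u) (combine {7} {b} (block p q) i)))
        set⇒hit u p q i = ≤-trans (≤-reflexive (cong [_] (lookup∘tabulate bit x))) (helper (own x) refl)
          where
          z = combine {7} {b} (block p q) i
          x = cell u (block p q) i
          helper : ∀ o → own x ≡ o → [ maybe (λ v → value v (groupOf x)) false o ] ≤ positive (mult (toList D) z (lookup (lookup G u) z))
          helper nothing  _ = z≤n
          helper (just v) eq
            rewrite groupOf-combine (block p q) i (lookup (lookup G u) z) | value-block v p q with lookup S v in v∈S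
          ... | false = z≤n
          ... | true  = hit (subst (λ c → 0 < mult (toList D) z c) (contains⇒≡ (lookup G v) z (lookup (lookup G u) z) (sound x v eq))
                          (mult-∈ z (∈-selectedPadded _ S G S≤n v v∈S)))
            where
            hit : ∀ {y} → 0 < y → 1 ≤ positive y
            hit (s≤s _) = s≤s z≤n

        member-yes : ∀ u → lookup S u ≡ true → eval (queryTree u) memory ≡ true
        member-yes u u∈S = trans (eval-query u) (threshold-true (cell u (block p q)) k memory (+-cancelʳ-≤ k₁ k _ (begin
          k + k₁                                                    ≡⟨ trans (sym (*-identityʳ b)) (sym (sum-const b 1)) ⟩
          sum {b} (λ _ → 1)                                         ≤⟨ sum-mono (λ i → lost-or-set u p q i u∈S) ⟩
          sum (λ i → [ lookup memory (cell u (block p q) i) ] + lost {L} {s} own G u (combine {7} {b} (block p q) i))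
                                                                    ≡⟨ ∑-distrib-+ (λ i → [ lookup memory (cell u (block p q) i) ]) (λ i → lost {L} {s} own G u (combine {7} {b} (block p q) i)) ⟩
          ones (cell u (block p q)) memory + groupLost u (block p q) ≤⟨ +-monoʳ-≤ _ (light u (cong (_∨ near u) u∈S)) ⟩
          ones (cell u (block p q)) memory + k₁                     ∎)))
          where
          open ≤-Reasoning
          p = rootBit u
          q = pointerBit u p

        nonmember-no : ∀ u → lookup S u ≡ false → eval (queryTree u) memory ≡ false
        nonmember-no u u∉S = trans (eval-query u) (threshold-false (cell u (block p q)) k memory (few (near u) refl))
          where
          p = rootBit u
          q = pointerBit u p
          few : ∀ a → near u ≡ a → ones (cell u (block p q)) memory < k
          few true  eq = s≤s (≤-trans (sum-mono (λ i → set⇒lost u p q i u∉S)) (light u (trans (cong (_∨ near u) u∉S) eq)))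
          few false eq = ≤-<-trans (≤-trans (sum-mono (set⇒hit u p q))
            (≤-trans (term≤sum (λ g → sum (λ i → hit (combine {7} {b} g i))) (block p q)) (≤-reflexive (sym (sum-combine 7 {b} hit)))))
            (≰⇒> (far eq))
            where
            hit : Fin L → ℕ
            hit z = positive (mult (toList D) z (lookup (lookup G u) z))
            far : near u ≡ false → ¬ k ≤ hits (toList D) (lookup G u)
            far e le = contradiction (trans (sym (dec-true (k ≤? hits (toList D) (lookup G u)) le)) e) λ ()

      ownership : Ownership (incidence {L} {s} G) demand
      ownership = hall (incidence {L} {s} G) demand activeHall

      open WithOwner (proj₁ ownership) (proj₁ (proj₂ ownership)) (proj₂ (proj₂ ownership)) public
        using (memory; member-yes; nonmember-no)

    scheme : Scheme m n (L * s) (suc (suc b))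
    scheme = record
      { store   = Memory.memory
      ; query   = queryTree
      ; correct = λ S h u →
          (λ yes! → lookup⇒[]= u S (decide S h u (lookup S u) refl yes!)) ,
          (λ u∈S → Memory.member-yes S h u ([]=⇒lookup u∈S))
      }
      where
      decide : ∀ S h u b → lookup S u ≡ b → eval (queryTree u) (Memory.memory S h) ≡ true → lookup S u ≡ true
      decide S h u true  eq _    = eq
      decide S h u false eq yes! = contradiction (trans (sym yes!) (Memory.nonmember-no S h u eq)) λ ()

-- Rational estimates

ℕtoℚ-mono : ∀ {a b} → a ≤ b → ℕtoℚ a Q.≤ ℕtoℚ b
ℕtoℚ-mono a≤b = *≤* (ℤ.*-monoʳ-≤-nonNeg (ℤ.+ 1) (ℤ.+≤+ a≤b))

ℕtoℚ-* : ∀ a b → ℕtoℚ (a * b) Q.≃ ℕtoℚ a Q.* ℕtoℚ b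
ℕtoℚ-* a b = *≡* (cong (ℤ._* ℤ.+ 1) (ℤ.pos-* a b))

ℕtoℚ-^ : ∀ a k → ℕtoℚ (a ^ k) Q.≃ ℕtoℚ a ^ℚ k
ℕtoℚ-^ a zero    = Q.≃-refl
ℕtoℚ-^ a (suc k) = Q.≃-trans (ℕtoℚ-* a (a ^ k)) (Q.*-congˡ {ℕtoℚ a} (ℕtoℚ-^ a k))

^ℚ-nonNeg : ∀ x k → Q.NonNegative x → Q.NonNegative (x ^ℚ k)
^ℚ-nonNeg x zero    h = _
^ℚ-nonNeg x (suc k) h = Q.nonNeg*nonNeg⇒nonNeg x {{h}} (x ^ℚ k) {{^ℚ-nonNeg x k h}}

^ℚ-mono : ∀ {x y} k → Q.NonNegative x → x Q.≤ y → x ^ℚ k Q.≤ y ^ℚ k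
^ℚ-mono     zero    h x≤y = Q.≤-refl
^ℚ-mono {x} (suc k) h x≤y = Q.*-mono-≤-nonNeg {{h}} {{^ℚ-nonNeg x k h}} x≤y (^ℚ-mono k h x≤y)

expTerm-nonNeg : ∀ k x → Q.NonNegative x → Q.NonNegative (expTerm k x)
expTerm-nonNeg zero    x h = _
expTerm-nonNeg (suc k) x h = Q.nonNeg*nonNeg⇒nonNeg (expTerm k x Q.* x)
  {{Q.nonNeg*nonNeg⇒nonNeg (expTerm k x) {{expTerm-nonNeg k x h}} x {{h}}}} (ℤ.+ 1 Q./ suc k)

expPartial-nonNeg : ∀ N x → Q.NonNegative x → Q.NonNegative (expPartial N x)
expPartial-nonNeg zero    x h = _
expPartial-nonNeg (suc N) x h = Q.nonNeg+nonNeg⇒nonNeg (expPartial N x) {{expPartial-nonNeg N x h}}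
  (expTerm N x) {{expTerm-nonNeg N x h}}

expTerm≤expPartial : ∀ N x → Q.NonNegative x → expTerm N x Q.≤ expPartial (suc N) x
expTerm≤expPartial N x h = Q.p≤q+p (expTerm N x) (expPartial N x) {{expPartial-nonNeg N x h}}

-- The overhead of the scheme is of order t². The truncation of e^(2t) after its quadratic term
-- contains (2t)²/2 = 2t², and the outer sum 1 + x dominates x.
t²≤expExpApprox : ∀ t → ℕtoℚ (t * t) Q.≤ expExpApprox 2 3 t
t²≤expExpApprox t = begin
  ℕtoℚ (t * t)              ≤⟨ *≤* (ℤ.≤-trans (ℤ.≤-reflexive (sym (ℤ.pos-* (t * t) 2))) (ℤ.≤-trans (ℤ.+≤+ square) (ℤ.≤-reflexive cast))) ⟩
  expTerm 2 y               ≤⟨ expTerm≤expPartial 2 y _ ⟩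
  x                         ≃⟨ Q.≃-sym (Q.≃-trans (Q.*-identityʳ (1ℚᵘ Q.* x)) (Q.*-identityˡ x)) ⟩
  expTerm 1 x               ≤⟨ expTerm≤expPartial 1 x (expPartial-nonNeg 3 y _) ⟩
  expExpApprox 2 3 t        ∎
  where
  open Q.≤-Reasoning
  y = ℤ.+ (2 * t) Q./ 1
  x = expPartial 3 y
  square : t * t * 2 ≤ 2 * t * (2 * t)
  square = ≤-trans (m≤m+n (t * t * 2) (t * t * 2)) (≤-reflexive (lemma t))
    where
    lemma : ∀ t → t * t * 2 + t * t * 2 ≡ 2 * t * (2 * t)
    lemma = solve-∀
  cast : ℤ.+ (2 * t * (2 * t)) ≡ (((ℤ.+ 1 ℤ.* ℤ.+ (2 * t)) ℤ.* ℤ.+ 1) ℤ.* ℤ.+ (2 * t)) ℤ.* ℤ.+ 1 ℤ.* ℤ.+ 1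
  cast = sym (trans (ℤ.*-identityʳ _) (trans (ℤ.*-identityʳ _)
    (trans (cong (ℤ._* ℤ.+ (2 * t)) (trans (ℤ.*-identityʳ _) (ℤ.*-identityˡ (ℤ.+ (2 * t))))) (sym (ℤ.pos-* (2 * t) (2 * t))))))

-- Numerical estimates

n<2^n : ∀ n → n < 2 ^ n
n<2^n zero    = s≤s z≤n
n<2^n (suc n) = ≤-trans (≤-reflexive (cong suc (+-comm 1 n))) (≤-trans (+-mono-≤ (n<2^n n) (m^n>0 2 n)) (≤-reflexive (cong (λ x → 2 ^ n + x) (sym (+-identityʳ (2 ^ n))))))

m<2^[1+⌊log₂m⌋] : ∀ m → m < 2 ^ suc ⌊log₂ m ⌋
m<2^[1+⌊log₂m⌋] m = ≰⇒> λ le → 1+n≰n (≤-trans (≤-reflexive (sym (⌊log₂[2^n]⌋≡n (suc ⌊log₂ m ⌋)))) (⌊log₂⌋-mono-≤ le))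

^-cancelˡ-≤ : ∀ k .{{_ : NonZero k}} {x y} → x ^ k ≤ y ^ k → x ≤ y
^-cancelˡ-≤ k le = ≮⇒≥ λ lt → <⇒≱ (^-monoˡ-< k lt) le

-- Reaching `q` makes the union bounds work, while minimality bounds the space from above.
least-root : ∀ k q → 1 ≤ q → ∃ λ s → q ≤ s ^ suc k × pred s ^ suc k < q
least-root k q 1≤q = go q (m≤m*n q (q ^ k) {{m^n≢0 q k {{>-nonZero 1≤q}}}})
  where
  go : ∀ x → q ≤ x ^ suc k → ∃ λ s → q ≤ s ^ suc k × pred s ^ suc k < q
  go zero    le = contradiction (≤-trans 1≤q le) λ ()
  go (suc x) le with q ≤? x ^ suc k
  ... | yes le′ = go x le′
  ... | no ¬le  = suc x , le , ≰⇒> ¬le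

abstract
  3^14 : ℕ
  3^14 = 3 ^ 14

  3^14-def : 3 ^ 14 ≡ 3^14
  3^14-def = refl

  3^14*17≤2^27 : 3^14 * 17 ≤ 2 ^ 27
  3^14*17≤2^27 = ≤ᵇ⇒≤ _ _ tt

  -- 2 pays for rounding s up, 32 * 3^14 * 17 comes from the quantity q below, and 49 from L ≤ 7 t.
  constant : ℕ
  constant = 2 * 32 * 3^14 * 17 * 49

  constant-def : constant ≡ 2 * 32 * 3^14 * 17 * 49
  constant-def = refl

-- Choice of the parameters

module Parameters (L k d t m n ℓ : ℕ) (L≡ : L ≡ d + suc k) (1≤L : 1 ≤ L) (L≤7t : L ≤ 7 * t) (L≤14k : L ≤ 14 * k)
                  (1≤n : 1 ≤ n) (n≤m : n ≤ m) (m≤ : m ≤ 2 ^ suc ℓ) (7t≤ℓ : 7 * t ≤ ℓ) (27≤ℓ : 27 ≤ ℓ) where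

  -- The 16 is 2 * 8: the choice of `D` together with the surplus costs at most `s ^ (2 * (L * n))`,
  -- and `s` will be at most `2 ^ (8 * ℓ)`. `q` is the left side of the condition `root`.
  g₀ q : ℕ
  g₀ = 16 * (L * n * ℓ)
  q = 32 * 3 ^ L * m * (g₀ + n) ^ k

  1≤m : 1 ≤ m
  1≤m = ≤-trans 1≤n n≤m

  1≤ℓ : 1 ≤ ℓ
  1≤ℓ = ≤-trans (s≤s z≤n) 27≤ℓ

  Ln≤g₀ : L * n ≤ g₀
  Ln≤g₀ = ≤-trans (m≤m*n (L * n) ℓ {{>-nonZero 1≤ℓ}}) (m≤n*m (L * n * ℓ) 16)

  n≤g₀ : n ≤ g₀
  n≤g₀ = ≤-trans (m≤n*m n L {{>-nonZero 1≤L}}) Ln≤g₀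

  dn≤g₀ : d * n ≤ g₀
  dn≤g₀ = ≤-trans (*-monoˡ-≤ n (≤-trans (m≤m+n d (suc k)) (≤-reflexive (sym L≡)))) Ln≤g₀

  A≤ : g₀ + n ≤ 17 * (L * n * ℓ)
  A≤ = ≤-trans (+-monoʳ-≤ g₀ (≤-trans (m≤n*m n L {{>-nonZero 1≤L}}) (m≤m*n (L * n) ℓ {{>-nonZero 1≤ℓ}}))) (≤-reflexive (+-comm g₀ (L * n * ℓ)))

  1≤A : 1 ≤ g₀ + n
  1≤A = ≤-trans 1≤n (m≤n+m n g₀)

  -- As a k-th power of a constant, the factor leaves only a constant after the (k + 1)-st root.
  3^L≤ : 3 ^ L ≤ 3^14 ^ k
  3^L≤ = power 3 14 k 3^14-def L≤14k
    where
    power : ∀ x .{{_ : NonZero x}} e {y i} j → x ^ e ≡ y → i ≤ e * j → x ^ i ≤ y ^ j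
    power x e j refl le = ≤-trans (^-monoʳ-≤ x le) (≤-reflexive (sym (^-*-assoc x e j)))

  1≤cofactor : 1 ≤ 3 ^ L * m
  1≤cofactor = *-mono-≤ (m^n>0 3 L) 1≤m

  32≤q : 32 ≤ q
  32≤q = ≤-trans (m≤m*n 32 (3 ^ L * m * (g₀ + n) ^ k) {{>-nonZero (*-mono-≤ 1≤cofactor (m^n>0 (g₀ + n) {{>-nonZero 1≤A}} k))}})
           (≤-reflexive (lemma 32 (3 ^ L) m ((g₀ + n) ^ k)))
    where
    lemma : ∀ a b c e → a * (b * c * e) ≡ a * b * c * e
    lemma = solve-∀

  q≤ : q ≤ 32 * m * (3^14 * (17 * (L * n * ℓ))) ^ k
  q≤ = begin
    32 * 3 ^ L * m * (g₀ + n) ^ k                 ≤⟨ *-mono-≤ (*-monoˡ-≤ m (*-monoʳ-≤ 32 3^L≤)) (^-monoˡ-≤ k A≤) ⟩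
    32 * 3^14 ^ k * m * (17 * (L * n * ℓ)) ^ k    ≡⟨ lemma 32 (3^14 ^ k) m ((17 * (L * n * ℓ)) ^ k) ⟩
    32 * m * (3^14 ^ k * (17 * (L * n * ℓ)) ^ k)  ≡⟨ cong (32 * m *_) (^-distribʳ-* k 3^14 (17 * (L * n * ℓ))) ⟨
    32 * m * (3^14 * (17 * (L * n * ℓ))) ^ k      ∎
    where
    open ≤-Reasoning
    lemma : ∀ a b c e → a * b * c * e ≡ a * c * (b * e)
    lemma = solve-∀

  -- This breaks a circle: `s` depends on `g₀`, while `g₀` must be large in terms of log s. A crude
  -- a priori bound suffices. With p = 2^ℓ, the factor `32 * m` is at most p^3 and the base of the
  -- k-th power at most p^5, so 8 leaves room.
  q≤2^8ℓ : q ≤ (2 ^ (8 * ℓ)) ^ suc k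
  q≤2^8ℓ = ≤-trans q≤ (*-mono-≤ 32m≤ (^-monoˡ-≤ k (factor≤ 3^14 3^14*17≤2^27)))
    where
    open ≤-Reasoning
    p : ℕ
    p = 2 ^ ℓ
    1≤p : 1 ≤ p
    1≤p = m^n>0 2 ℓ
    ℓ≤p : ℓ ≤ p
    ℓ≤p = <⇒≤ (n<2^n ℓ)
    L≤p : L ≤ p
    L≤p = ≤-trans L≤7t (≤-trans 7t≤ℓ ℓ≤p)
    2≤p : 2 ≤ p
    2≤p = ^-monoʳ-≤ 2 {1} 1≤ℓ
    m≤p² : m ≤ p * p
    m≤p² = ≤-trans m≤ (*-monoˡ-≤ p 2≤p)
    p^8 : 2 ^ (8 * ℓ) ≡ p ^ 8
    p^8 = trans (cong (2 ^_) (*-comm 8 ℓ)) (sym (^-*-assoc 2 ℓ 8))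
    32m≤ : 32 * m ≤ 2 ^ (8 * ℓ)
    32m≤ = begin
      32 * m          ≤⟨ *-mono-≤ (^-monoʳ-≤ 2 {5} (≤-trans (m≤m+n 5 22) 27≤ℓ)) m≤p² ⟩
      p * (p * p)     ≡⟨ cong (λ x → p * (p * x)) (sym (*-identityʳ p)) ⟩
      p ^ 3           ≤⟨ ^-monoʳ-≤ p {{>-nonZero 1≤p}} {3} {8} (m≤m+n 3 5) ⟩
      p ^ 8           ≡⟨ p^8 ⟨
      2 ^ (8 * ℓ)     ∎
    factor≤ : ∀ c → c * 17 ≤ 2 ^ 27 → c * (17 * (L * n * ℓ)) ≤ 2 ^ (8 * ℓ)
    factor≤ c c≤ = begin
      c * (17 * (L * n * ℓ))   ≡⟨ *-assoc c 17 (L * n * ℓ) ⟨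
      c * 17 * (L * n * ℓ)     ≤⟨ *-mono-≤ (≤-trans c≤ (^-monoʳ-≤ 2 27≤ℓ)) (*-mono-≤ (*-mono-≤ L≤p (≤-trans n≤m m≤p²)) ℓ≤p) ⟩
      p * (p * (p * p) * p)    ≡⟨ lemma p ⟩
      p ^ 5                    ≤⟨ ^-monoʳ-≤ p {{>-nonZero 1≤p}} {5} {8} (m≤m+n 5 3) ⟩
      p ^ 8                    ≡⟨ p^8 ⟨
      2 ^ (8 * ℓ)              ∎
      where
      lemma : ∀ p → p * (p * (p * p) * p) ≡ p * (p * (p * (p * (p * 1))))
      lemma = solve-∀

  module Root (s : ℕ) (q≤s : q ≤ s ^ suc k) (least : pred s ^ suc k < q) where

    2≤s : 2 ≤ s
    2≤s = ≰⇒> λ s≤1 → <⇒≱ (≤-trans (s≤s (s≤s z≤n)) 32≤q) (≤-trans q≤s (≤-trans (^-monoˡ-≤ (suc k) s≤1) (≤-reflexive (^-zeroˡ (suc k)))))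

    1≤s : 1 ≤ s
    1≤s = ≤-trans (s≤s z≤n) 2≤s

    s≤2^8ℓ : s ≤ 2 ^ (8 * ℓ)
    s≤2^8ℓ = ≮⇒≥ λ lt → <⇒≱ least (≤-trans q≤2^8ℓ (^-monoˡ-≤ (suc k) (pred-mono-≤ lt)))

    size : s ^ (2 * (L * n)) ≤ 2 ^ g₀
    size = begin
      s ^ (2 * (L * n))                ≤⟨ ^-monoˡ-≤ (2 * (L * n)) s≤2^8ℓ ⟩
      (2 ^ (8 * ℓ)) ^ (2 * (L * n))    ≡⟨ ^-*-assoc 2 (8 * ℓ) (2 * (L * n)) ⟩
      2 ^ (8 * ℓ * (2 * (L * n)))      ≡⟨ cong (2 ^_) (lemma ℓ (L * n)) ⟩
      2 ^ g₀                           ∎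
      where
      open ≤-Reasoning
      lemma : ∀ l x → 8 * l * (2 * x) ≡ 16 * (x * l)
      lemma = solve-∀

    n≤s : n ≤ s
    n≤s = ^-cancelˡ-≤ (suc k) (≤-trans (*-mono-≤ (≤-trans n≤m (m≤n*m m (32 * 3 ^ L) {{>-nonZero (*-mono-≤ (s≤s (z≤n {31})) (m^n>0 3 L))}})) (^-monoˡ-≤ k (m≤n+m n g₀))) q≤s)

    admissible : ∃ (Admissible L s m n k d (g₀ + n) g₀)
    admissible = admissible-rows L s m n k d g₀ L≡ 1≤n n≤s 1≤m n≤g₀ dn≤g₀ q≤s size

    -- Everything except `m * n ^ k` is raised to the power k + 1, so that it comes out of the root
    -- as a plain factor. Of the two factors `L` that become t², one is the number of arrays and the
    -- other comes from `g₀`.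
    root-bound : (L * s) ^ suc k ≤ (constant * (t * t) * ℓ) ^ suc k * (m * n ^ k)
    root-bound = begin
      (L * s) ^ suc k
        ≤⟨ ^-monoˡ-≤ (suc k) (*-monoʳ-≤ L s≤2pred) ⟩
      (L * (2 * pred s)) ^ suc k
        ≡⟨ trans (cong (_^ suc k) (sym (*-assoc L 2 (pred s)))) (^-distribʳ-* (suc k) (L * 2) (pred s)) ⟩
      (L * 2) ^ suc k * pred s ^ suc k
        ≤⟨ *-monoʳ-≤ ((L * 2) ^ suc k) (≤-trans (<⇒≤ least) q≤) ⟩
      (L * 2) ^ suc k * (32 * m * (c * (17 * (L * n * ℓ))) ^ k)
        ≡⟨ cong (λ e → (L * 2) ^ suc k * (32 * m * e)) (trans (cong (_^ k) (pull-n c 17 L n ℓ)) (^-distribʳ-* k (c * 17 * L * ℓ) n)) ⟩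
      (L * 2) ^ suc k * (32 * m * ((c * 17 * L * ℓ) ^ k * n ^ k))
        ≡⟨ regroup ((L * 2) ^ suc k) 32 m ((c * 17 * L * ℓ) ^ k) (n ^ k) ⟩
      (L * 2) ^ suc k * (32 * (c * 17 * L * ℓ) ^ k) * (m * n ^ k)
        ≤⟨ *-monoˡ-≤ (m * n ^ k) (*-monoʳ-≤ ((L * 2) ^ suc k) (*-mono-≤ (m≤m*n 32 (32 ^ k) {{m^n≢0 32 k}}) (m≤n*m ((c * 17 * L * ℓ) ^ k) (c * 17 * L * ℓ) {{>-nonZero 1≤y}}))) ⟩
      (L * 2) ^ suc k * (32 ^ suc k * (c * 17 * L * ℓ) ^ suc k) * (m * n ^ k)
        ≡⟨ cong (_* (m * n ^ k)) (trans (cong ((L * 2) ^ suc k *_) (sym (^-distribʳ-* (suc k) 32 (c * 17 * L * ℓ)))) (sym (^-distribʳ-* (suc k) (L * 2) (32 * (c * 17 * L * ℓ))))) ⟩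
      (L * 2 * (32 * (c * 17 * L * ℓ))) ^ suc k * (m * n ^ k)
        ≤⟨ *-monoˡ-≤ (m * n ^ k) (^-monoˡ-≤ (suc k) base≤) ⟩
      (constant * (t * t) * ℓ) ^ suc k * (m * n ^ k) ∎
      where
      open ≤-Reasoning
      c : ℕ
      c = 3^14
      s≤2pred : s ≤ 2 * pred s
      s≤2pred = half s 2≤s
        where
        half : ∀ s → 2 ≤ s → s ≤ 2 * pred s
        half (suc (suc s)) (s≤s (s≤s _)) = ≤-trans (s≤s (s≤s (m≤m+n s s))) (≤-reflexive (lemma s))
          where
          lemma : ∀ s → suc (suc (s + s)) ≡ 2 * suc s
          lemma = solve-∀
      pull-n : ∀ c e L n l → c * (e * (L * n * l)) ≡ c * e * L * l * n
      pull-n = solve-∀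
      regroup : ∀ a b m x y → a * (b * m * (x * y)) ≡ a * (b * x) * (m * y)
      regroup = solve-∀
      1≤c : 1 ≤ c
      1≤c = subst (1 ≤_) 3^14-def (m^n>0 3 14)
      1≤y : 1 ≤ c * 17 * L * ℓ
      1≤y = *-mono-≤ (*-mono-≤ (*-mono-≤ 1≤c (s≤s (z≤n {16}))) 1≤L) 1≤ℓ
      base≤ : L * 2 * (32 * (c * 17 * L * ℓ)) ≤ constant * (t * t) * ℓ
      base≤ = begin
        L * 2 * (32 * (c * 17 * L * ℓ))               ≡⟨ collect L 2 32 c 17 ℓ ⟩
        2 * 32 * c * 17 * (L * L) * ℓ                 ≤⟨ *-monoˡ-≤ ℓ (*-monoʳ-≤ (2 * 32 * c * 17) (*-mono-≤ L≤7t L≤7t)) ⟩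
        2 * 32 * c * 17 * (7 * t * (7 * t)) * ℓ       ≡⟨ cong (_* ℓ) (trans (cong (2 * 32 * c * 17 *_) (sevens t)) (sym (*-assoc (2 * 32 * c * 17) 49 (t * t)))) ⟩
        2 * 32 * c * 17 * 49 * (t * t) * ℓ            ≡⟨ cong (λ x → x * (t * t) * ℓ) (sym constant-def) ⟩
        constant * (t * t) * ℓ                        ∎
        where
        collect : ∀ L a b c e l → L * a * (b * (c * e * L * l)) ≡ a * b * c * e * (L * L) * l
        collect = solve-∀
        sevens : ∀ t → 7 * t * (7 * t) ≡ 49 * (t * t)
        sevens = solve-∀

    -- Squaring turns k + 1 into t + 1 and 2k into t - 1, so that the fractional exponents 2/(t + 1)
    -- and 1 - 2/(t + 1) are expressed without roots.
    squared-bound : suc k * 2 ≡ t + 1 → k * 2 ≡ t ∸ 1 →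
                    (L * s) ^ (t + 1) ≤ (constant * (t * t) * ℓ) ^ (t + 1) * (m ^ 2 * n ^ (t ∸ 1))
    squared-bound exponent exponent′ = subst₂ _≤_ (power (L * s)) (trans (*-square ((constant * (t * t) * ℓ) ^ suc k) m (n ^ k))
        (cong₂ (λ x y → x * (m ^ 2 * y)) (power (constant * (t * t) * ℓ)) (trans (^-*-assoc n k 2) (cong (n ^_) exponent′))))
      (^-monoˡ-≤ 2 root-bound)
      where
      power : ∀ x → (x ^ suc k) ^ 2 ≡ x ^ (t + 1)
      power x = trans (^-*-assoc x (suc k) 2) (cong (x ^_) exponent)
      *-square : ∀ x m y → (x * (m * y)) ^ 2 ≡ x ^ 2 * (m ^ 2 * y ^ 2)
      *-square x m y = trans (^-distribʳ-* 2 x (m * y)) (cong (x ^ 2 *_) (^-distribʳ-* 2 m y))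

bound-in-ℚ : ∀ s c t l e → s ^ (t + 1) ≤ (c * (t * t) * l) ^ (t + 1) * e →
  ℕtoℚ s ^ℚ (t + 1) Q.≤ ((ℕtoℚ c Q.* expExpApprox 2 3 t) Q.* ℕtoℚ l) ^ℚ (t + 1) Q.* ℕtoℚ e
bound-in-ℚ s c t l e le = begin
  ℕtoℚ s ^ℚ (t + 1)                                       ≃⟨ Q.≃-sym (ℕtoℚ-^ s (t + 1)) ⟩
  ℕtoℚ (s ^ (t + 1))                                      ≤⟨ ℕtoℚ-mono le ⟩
  ℕtoℚ ((c * (t * t) * l) ^ (t + 1) * e)                  ≃⟨ Q.≃-trans (ℕtoℚ-* ((c * (t * t) * l) ^ (t + 1)) e) (Q.*-congʳ {ℕtoℚ e} (ℕtoℚ-^ (c * (t * t) * l) (t + 1))) ⟩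
  ℕtoℚ (c * (t * t) * l) ^ℚ (t + 1) Q.* ℕtoℚ e            ≤⟨ Q.*-monoˡ-≤-nonNeg (ℕtoℚ e) (^ℚ-mono (t + 1) _ base) ⟩
  ((ℕtoℚ c Q.* expExpApprox 2 3 t) Q.* ℕtoℚ l) ^ℚ (t + 1) Q.* ℕtoℚ e ∎
  where
  open Q.≤-Reasoning
  base : ℕtoℚ (c * (t * t) * l) Q.≤ (ℕtoℚ c Q.* expExpApprox 2 3 t) Q.* ℕtoℚ l
  base = begin
    ℕtoℚ (c * (t * t) * l)                        ≃⟨ Q.≃-trans (ℕtoℚ-* (c * (t * t)) l) (Q.*-congʳ {ℕtoℚ l} (ℕtoℚ-* c (t * t))) ⟩
    (ℕtoℚ c Q.* ℕtoℚ (t * t)) Q.* ℕtoℚ l          ≤⟨ Q.*-monoˡ-≤-nonNeg (ℕtoℚ l) (Q.*-monoʳ-≤-nonNeg (ℕtoℚ c) (t²≤expExpApprox t)) ⟩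
    (ℕtoℚ c Q.* expExpApprox 2 3 t) Q.* ℕtoℚ l    ∎

-- The space bound for odd depth

theorem5 : (p q : ℕ) → 1 ≤ p → 1 ≤ q →
    ∃ λ (C : ℕ) → ∃ λ (M₀ : ℕ) →
    ∀ m → M₀ ≤ m →
    ∀ t → Odd t → 3 ≤ t → 2 ^ (2 ^ (10 * t)) ≤ m →
    ∀ n → 1 ≤ n → n ^ q * m ^ p ≤ m ^ q →
    ∃ λ (s : ℕ) → Scheme m n s t × ∃₂ λ (N K : ℕ) →
    (ℕtoℚ s) ^ℚ (t + 1)
    Q.≤ ((ℕtoℚ C Q.* expExpApprox N K t) Q.* ℕtoℚ (⌊log₂ m ⌋)) ^ℚ (t + 1)
    Q.* ℕtoℚ (m ^ 2 * n ^ (t ∸ 1))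
-- The witness 0 for `M₀` suffices because `3 ≤ t` and `2 ^ (2 ^ (10 * t)) ≤ m` already force `m` to
-- be at least 2^(2^30).
theorem5 p q 1≤p 1≤q = constant , 0 , λ m _ → build m
  where
  build : ∀ m t → Odd t → 3 ≤ t → 2 ^ (2 ^ (10 * t)) ≤ m → ∀ n → 1 ≤ n → n ^ q * m ^ p ≤ m ^ q →
    ∃ λ s → Scheme m n s t × ∃₂ λ N K →
    (ℕtoℚ s) ^ℚ (t + 1)
    Q.≤ ((ℕtoℚ constant Q.* expExpApprox N K t) Q.* ℕtoℚ (⌊log₂ m ⌋)) ^ℚ (t + 1)
    Q.* ℕtoℚ (m ^ 2 * n ^ (t ∸ 1))
  build m t (zero , refl) (s≤s ()) large n 1≤n sparse
  build m t (suc k₁ , t≡) 3≤t large n 1≤n sparse = finish (trans t≡ (lemma k₁))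
    where
    lemma : ∀ k → suc (2 * suc k) ≡ 3 + (k + k)
    lemma = solve-∀
    1≤m : 1 ≤ m
    1≤m = ≤-trans (m^n>0 2 (2 ^ (10 * t))) large
    n≤m : n ≤ m
    n≤m = ^-cancelˡ-≤ q {{>-nonZero 1≤q}} (≤-trans (m≤m*n (n ^ q) (m ^ p) {{m^n≢0 m p {{>-nonZero 1≤m}}}}) sparse)
    2^10t≤ : 2 ^ (10 * t) ≤ ⌊log₂ m ⌋
    2^10t≤ = ≤-trans (≤-reflexive (sym (⌊log₂[2^n]⌋≡n (2 ^ (10 * t))))) (⌊log₂⌋-mono-≤ large)
    10t≤ : 10 * t ≤ ⌊log₂ m ⌋
    10t≤ = ≤-trans (<⇒≤ (n<2^n (10 * t))) 2^10t≤
    k b L : ℕ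
    k = suc k₁
    b = suc (k₁ + k₁)
    L = 7 * b
    -- The demand `d = 5 + 13 * k₁` is L - k - 1 written without subtraction.
    L≡ : L ≡ 5 + 13 * k₁ + suc k
    L≡ = arithmetic k₁
      where
      arithmetic : ∀ k → 7 * suc (k + k) ≡ 5 + 13 * k + suc (suc k)
      arithmetic = solve-∀
    L≤14k : L ≤ 14 * k
    L≤14k = ≤-trans (m≤m+n L 7) (≤-reflexive (arithmetic k₁))
      where
      arithmetic : ∀ k → 7 * suc (k + k) + 7 ≡ 14 * suc k
      arithmetic = solve-∀
    exponent : suc k * 2 ≡ 3 + (k₁ + k₁) + 1
    exponent = arithmetic k₁
      where
      arithmetic : ∀ k → suc (suc k) * 2 ≡ 3 + (k + k) + 1
      arithmetic = solve-∀
    exponent′ : k * 2 ≡ 2 + (k₁ + k₁)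
    exponent′ = arithmetic k₁
      where
      arithmetic : ∀ k → suc k * 2 ≡ 2 + (k + k)
      arithmetic = solve-∀
    finish : t ≡ 2 + b → ∃ λ s → Scheme m n s t × ∃₂ λ N K →
      (ℕtoℚ s) ^ℚ (t + 1)
      Q.≤ ((ℕtoℚ constant Q.* expExpApprox N K t) Q.* ℕtoℚ (⌊log₂ m ⌋)) ^ℚ (t + 1)
      Q.* ℕtoℚ (m ^ 2 * n ^ (t ∸ 1))
    finish t≡2+b = L * s , subst (Scheme m n (L * s)) (sym t≡2+b) (scheme admissible) , 2 , 3 ,
        bound-in-ℚ (L * s) constant t ⌊log₂ m ⌋ (m ^ 2 * n ^ (t ∸ 1))
          (squared-bound (trans exponent (cong (_+ 1) (sym t≡2+b))) (trans exponent′ (cong (_∸ 1) (sym t≡2+b))))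
      where
      L≤7t : L ≤ 7 * t
      L≤7t = *-monoʳ-≤ 7 (≤-trans (m≤n+m b 2) (≤-reflexive (sym t≡2+b)))
      open Parameters L k (5 + 13 * k₁) t m n ⌊log₂ m ⌋ L≡ (s≤s z≤n) L≤7t L≤14k
        1≤n n≤m (<⇒≤ (m<2^[1+⌊log₂m⌋] m))
        (≤-trans (*-monoˡ-≤ t (m≤m+n 7 3)) 10t≤)
        (≤-trans (m≤m+n 27 3) (≤-trans (*-monoʳ-≤ 10 3≤t) 10t≤)) renaming (q to target) hiding (1≤m)
      minimal : ∃ λ s → target ≤ s ^ suc k × pred s ^ suc k < target
      minimal = least-root k target (≤-trans (s≤s z≤n) 32≤q)
      s : ℕ
      s = proj₁ minimal
      open Root s (proj₁ (proj₂ minimal)) (proj₂ (proj₂ minimal))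
      scheme : ∃ (Admissible L s m n k (5 + 13 * k₁) (g₀ + n) g₀) → Scheme m n (L * s) (2 + b)
      scheme (G , adm) = Construction.scheme k₁ s m n (5 + 13 * k₁) g₀ 1≤s L≡ G adm
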